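{- For every integer $r\equiv1\pmod4$ with $r\ge9$, $\operatorname{pn}(\mathcal C_4(r))=r+1$.
   Context: $\mathcal C_4(r)$ is the directed Cayley digraph on $\mathbb Z_{4r}$ with arcs $x\to x+s$ for all $x\in\mathbb Z_{4r}$ and $s\in\{1,\ldots,r\}$. For a digraph $D$, the path number $\operatorname{pn}(D)$ is the minimum number of simple directed paths whose arc sets partition the arc set of $D$. -}

module Defs where

open import Data.Fin.Base using (Fin; toℕ)
open import Data.Fin.Properties using (nonZeroIndex)
open import Data.List.Base using (List; drop; length; zip)
open import Data.List.Membership.Propositional using (_∈_)
open import Data.List.Relation.Unary.Linked using (Linked)
open import Data.List.Relation.Unary.Unique.Propositional using (Unique)
open import Data.Nat.Base using (ℕ; _+_; _*_; _≤_)
open import Data.Nat.DivMod using (_mod_)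
open import Data.Product using (∃; ∃!; _×_; _,_)
open import Relation.Binary.Core using (Rel)
open import Relation.Binary.PropositionalEquality.Core using (_≡_)
open import Relation.Unary using (Pred)
open import Level using (0ℓ)

record Digraph : Set₁ where
  field
    order : ℕ
    Arc   : Rel (Fin order) 0ℓ

  Vertex : Set
  Vertex = Fin order

-- A simple directed path, given by its sequence of vertices.  At least one
-- arc is required, because the parts of a partition are nonempty.
record Path (D : Digraph) : Set where
  open Digraph D
  field
    vertices   : List Vertex
    nontrivial : 2 ≤ length vertices
    simple     : Unique vertices
    directed   : Linked Arc vertices

  arcs : List (Vertex × Vertex)
  arcs = zip vertices (drop 1 vertices)

-- Every arc lies on exactly one of the k paths.  The converse inclusion, that
-- the paths only use arcs of D, is the field `directed`.
record PathDecomposition (D : Digraph) (k : ℕ) : Set where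
  open Digraph D
  field
    path       : Fin k → Path D
    partitions : ∀ {u v} → Arc u v →
                 ∃! _≡_ λ i → (u , v) ∈ Path.arcs (path i)

-- pn(D) = k
record IsPathNumber (D : Digraph) (k : ℕ) : Set where
  field
    attained : PathDecomposition D k
    minimum  : ∀ m → PathDecomposition D m → k ≤ m

-- Addition in ℤ/n, whose elements are represented by Fin n.
infixl 6 _⊕_
_⊕_ : ∀ {n} → Fin n → Fin n → Fin n
_⊕_ {n} x y = (toℕ x + toℕ y) mod n
  where instance _ = nonZeroIndex x

cayley : (n : ℕ) → Pred (Fin n) 0ℓ → Digraph
cayley n S = record
  { order = n
  ; Arc   = λ x y → ∃ λ s → S s × y ≡ x ⊕ s
  }

𝒞₄ : ℕ → Digraph
𝒞₄ r = cayley (4 * r) λ s → 1 ≤ toℕ s × toℕ s ≤ r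

-- Write r = 4q + 1.  A path has at most 4r − 1 arcs and there are 4r² arcs, so
-- r paths do not suffice.  For the other direction it is enough to decompose
-- 𝒞₄(r) into r Hamiltonian cycles together with a path of length r that uses
-- one arc of each: deleting those arcs leaves r Hamiltonian paths.
--
-- The r cycles are the translates by 0, 2, …, 2(r − 1) of a single one, which
-- is invariant under translation by 2r.  Its jump function x ↦ next x − x takes
-- every value in 1, …, r once on the even and once on the odd residues modulo
-- 2r, so each arc lies in exactly one translate.  One pass over the residues
-- modulo 2r winds r(r + 1)/2r = 2q + 1 times around; this is odd, so the pass
-- closes up modulo 4r only after its second round.  The rainbow path is
-- r, r + 2, …, r + 2q, 10q, 10q + 2, …, 16q.

module Submission where

open import Defs
open import Data.Nat.Base
open import Data.Nat.Properties
open import Data.Nat.DivMod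
open import Data.Nat.Divisibility using (divides)
open import Data.Nat.Tactic.RingSolver using (solve-∀)
open import Data.Fin.Base as Fin using (Fin; zero; suc; toℕ; fromℕ<; punchOut; combine; remQuot)
import Data.Fin.Properties as Fin
open import Data.List.Base using (List; []; _∷_; [_]; _++_; length; drop; zip; applyUpTo; lookup)
open import Data.List.Properties using (length-++; length-zipWith; length-drop; length-applyUpTo)
open import Data.List.Membership.Propositional using (_∈_)
open import Data.List.Membership.Propositional.Properties using (∈-applyUpTo⁺; ∈-applyUpTo⁻; ∈-lookup)
open import Data.List.Membership.Setoid.Properties using (index-injective)
import Data.List.Relation.Unary.All as All
open import Data.List.Relation.Unary.AllPairs using (_∷_)
open import Data.List.Relation.Unary.Any using (index)
import Data.List.Relation.Unary.Linked.Properties as Linked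
open import Data.List.Relation.Unary.Unique.Propositional using (Unique)
import Data.List.Relation.Unary.Unique.Propositional.Properties as Unique
open import Data.Product using (∃; ∃!; ∃₂; _×_; _,_; proj₁; proj₂; uncurry)
open import Data.Product.Properties using (,-injectiveˡ; ,-injectiveʳ)
open import Data.Sum using (_⊎_; inj₁; inj₂)
open import Function using (_∘_)
open import Function.Definitions using (Injective)
open import Relation.Nullary using (yes; no; contradiction)
open import Relation.Binary.Definitions using (tri<; tri≈; tri>)
open import Relation.Binary.PropositionalEquality
  using (_≡_; _≢_; refl; sym; trans; cong; cong₂; subst; subst₂; setoid; module ≡-Reasoning)

-- The congruence on r enters through the winding number. A pass over the residues modulo 2r uses
-- every jump twice and so winds (r + 1) / 2 times around, which is an odd integer exactly when r ≡
-- 1 modulo 4. The order of the jumps makes the orbit easy to follow by hand: on each block `next`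
-- is a reflection, and an even number of reflections composes to a translation. The orbit therefore
-- consists of a few strands of constant difference, plus finitely many exceptional passages that
-- join them. Neither injectivity of the orbit nor disjointness of the translates is computed from
-- the table. An orbit that covers a finite set cannot repeat a point before it has exhausted the
-- set, so reachability of every vertex from 0 is enough. Likewise, if every arc lies in some
-- translate, equality of the two counts makes that translate unique, so it is enough that each row
-- of the table contains every jump.

-- Counting in finite sets, and orbits

injective⇒strictlySurjective : ∀ {n} {f : Fin n → Fin n} → Injective _≡_ _≡_ f →
                               ∀ y → ∃ λ x → f x ≡ y
injective⇒strictlySurjective {suc n} {f} inj y with Fin.any? (λ x → f x Fin.≟ y)
... | yes p = p
... | no ¬p = contradiction (Fin.injective⇒≤ inj′) (<⇒≱ (n<1+n n))
  where
  y≢ : ∀ x → y ≢ f x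
  y≢ x y≡fx = ¬p (x , sym y≡fx)
  inj′ : Injective _≡_ _≡_ (λ x → punchOut (y≢ x))
  inj′ eq = inj (Fin.punchOut-injective (y≢ _) (y≢ _) eq)

×-injective⇒strictlySurjective : ∀ {m n} (f : Fin m × Fin n → Fin m × Fin n) →
                                 (∀ a b → f a ≡ f b → a ≡ b) → ∀ y → ∃ λ x → f x ≡ y
×-injective⇒strictlySurjective {m} {n} f f-injective (i , j) =
  split (proj₁ preimage) , combine′-injective (proj₂ preimage)
  where
  split : Fin (m * n) → Fin m × Fin n
  split = remQuot n
  combine′ : Fin m × Fin n → Fin (m * n)
  combine′ (i , j) = combine i j
  combine′-injective : ∀ {a b} → combine′ a ≡ combine′ b → a ≡ b
  combine′-injective {i , j} {k , l} eq with refl , refl ← Fin.combine-injective i j k l eq = refl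
  split-injective : ∀ {a b} → split a ≡ split b → a ≡ b
  split-injective {a} {b} eq = trans (sym (Fin.combine-remQuot {m} n a))
    (trans (cong combine′ eq) (Fin.combine-remQuot {m} n b))
  preimage : ∃ λ c → combine′ (f (split c)) ≡ combine i j
  preimage = injective⇒strictlySurjective (split-injective ∘ f-injective _ _ ∘ combine′-injective) (combine i j)

-- `o-suc` says that `o` is the orbit of a self-map of its image, without naming that map. The
-- module turns reachability into Hamiltonicity.
module Orbit {n : ℕ} (o : ℕ → Fin n)
             (o-suc : ∀ {i j} → o i ≡ o j → o (suc i) ≡ o (suc j))
             (o-surjective : ∀ x → ∃ λ i → o i ≡ x) where

  -- Once o j repeats o i, an index that would step onto j is sent back to i.
  o-reduce : ∀ {i j} → i < j → o i ≡ o j → ∀ l → ∃ λ l′ → l′ < j × o l′ ≡ o l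
  o-reduce {i} {j} i<j eq zero    = 0 , ≤-<-trans z≤n i<j , refl
  o-reduce {i} {j} i<j eq (suc l) with o-reduce i<j eq l
  ... | l′ , l′<j , eq′ with m≤n⇒m<n∨m≡n l′<j
  ...   | inj₁ l″<j = suc l′ , l″<j , o-suc eq′
  ...   | inj₂ refl = i , i<j , trans eq (o-suc eq′)

  o-surjective-< : ∀ x → ∃ λ i → i < n × o i ≡ x
  o-surjective-< x with Fin.pigeonhole (n<1+n n) (o ∘ toℕ) | o-surjective x
  ... | i , j , i<j , eq | l , refl with o-reduce i<j eq l
  ...   | l′ , l′<j , eq′ = l′ , <-≤-trans l′<j (s≤s⁻¹ (Fin.toℕ<n j)) , eq′

  -- A repetition at j < n would confine all n points to the j positions before it.
  o-injective-< : ∀ {i j} → i < j → j < n → o i ≢ o j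
  o-injective-< {i} {j} i<j j<n eq = contradiction (Fin.injective⇒≤ pos-injective) (<⇒≱ j<n)
    where
    position : ∀ x → ∃ λ l → l < j × o l ≡ x
    position x with o-surjective x
    ... | l , refl = o-reduce i<j eq l
    pos : Fin n → Fin j
    pos x = fromℕ< (proj₁ (proj₂ (position x)))
    o-pos : ∀ x → o (toℕ (pos x)) ≡ x
    o-pos x = trans (cong o (Fin.toℕ-fromℕ< _)) (proj₂ (proj₂ (position x)))
    pos-injective : Injective _≡_ _≡_ pos
    pos-injective {x} {y} eq = trans (sym (o-pos x)) (trans (cong (o ∘ toℕ) eq) (o-pos y))

-- Arcs of paths given as vertex lists

Unique⇒lookup-injective : ∀ {A : Set} {xs : List A} → Unique xs → Injective _≡_ _≡_ (lookup xs)
Unique⇒lookup-injective (_ ∷ _) {zero}  {zero}  eq = refl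
Unique⇒lookup-injective (x≢ ∷ _) {zero}  {suc j} eq = contradiction eq (All.lookup x≢ (∈-lookup j))
Unique⇒lookup-injective (x≢ ∷ _) {suc i} {zero}  eq = contradiction (sym eq) (All.lookup x≢ (∈-lookup i))
Unique⇒lookup-injective (_ ∷ u) {suc i} {suc j} eq = cong suc (Unique⇒lookup-injective u eq)

consecutive-applyUpTo : ∀ {A : Set} (f : ℕ → A) n →
  zip (applyUpTo f (suc n)) (applyUpTo (f ∘ suc) n) ≡ applyUpTo (λ i → f i , f (suc i)) n
consecutive-applyUpTo f zero    = refl
consecutive-applyUpTo f (suc n) = cong (_ ∷_) (consecutive-applyUpTo (f ∘ suc) n)

length-arcs : ∀ {D} (P : Path D) → length (Path.arcs P) < Digraph.order D
length-arcs {D} P = begin-strict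
  length (zip vertices (drop 1 vertices))      ≡⟨ length-zipWith _ vertices (drop 1 vertices) ⟩
  length vertices ⊓ length (drop 1 vertices)   ≤⟨ m⊓n≤n _ _ ⟩
  length (drop 1 vertices)                     ≡⟨ length-drop 1 vertices ⟩
  length vertices ∸ 1                          <⟨ ∸-monoʳ-< z<s (<⇒≤ nontrivial) ⟩
  length vertices                              ≤⟨ Fin.injective⇒≤ (Unique⇒lookup-injective simple) ⟩
  Digraph.order D                              ∎
  where
  open Path P
  open ≤-Reasoning

-- Walks and residues

module Walk (jump : ℕ → ℕ) where

  next : ℕ → ℕ
  next x = x + jump x

  walk : ℕ → ℕ → ℕ
  walk zero    x = x
  walk (suc n) x = next (walk n x)

  walk-+ : ∀ m n x → walk (m + n) x ≡ walk m (walk n x)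
  walk-+ zero    n x = refl
  walk-+ (suc m) n x = cong next (walk-+ m n x)

module Residue (n : ℕ) .{{_ : NonZero n}} where

  ⟦_⟧ : ℕ → Fin n
  ⟦ x ⟧ = x mod n

  toℕ-⟦⟧ : ∀ x → toℕ ⟦ x ⟧ ≡ x % n
  toℕ-⟦⟧ x = Fin.toℕ-fromℕ< (m%n<n x n)

  ⟦⟧-cong : ∀ {x y} → x % n ≡ y % n → ⟦ x ⟧ ≡ ⟦ y ⟧
  ⟦⟧-cong {x} {y} eq = Fin.toℕ-injective (trans (toℕ-⟦⟧ x) (trans eq (sym (toℕ-⟦⟧ y))))

  ⟦⟧-% : ∀ {x y} → ⟦ x ⟧ ≡ ⟦ y ⟧ → x % n ≡ y % n
  ⟦⟧-% {x} {y} eq = trans (sym (toℕ-⟦⟧ x)) (trans (cong toℕ eq) (toℕ-⟦⟧ y))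

  ⟦toℕ⟧ : ∀ x → ⟦ toℕ x ⟧ ≡ x
  ⟦toℕ⟧ x = Fin.toℕ-injective (trans (toℕ-⟦⟧ _) (m<n⇒m%n≡m (Fin.toℕ<n x)))

  ⟦+*⟧ : ∀ x k → ⟦ x + k * n ⟧ ≡ ⟦ x ⟧
  ⟦+*⟧ x k = ⟦⟧-cong ([m+kn]%n≡m%n x k n)

  +-congʳ-⟦⟧ : ∀ {x y} z → ⟦ x ⟧ ≡ ⟦ y ⟧ → ⟦ z + x ⟧ ≡ ⟦ z + y ⟧
  +-congʳ-⟦⟧ {x} {y} z eq = ⟦⟧-cong (begin
    (z + x) % n          ≡⟨ %-distribˡ-+ z x n ⟩
    (z % n + x % n) % n  ≡⟨ cong (λ w → (z % n + w) % n) (⟦⟧-% eq) ⟩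
    (z % n + y % n) % n  ≡⟨ %-distribˡ-+ z y n ⟨
    (z + y) % n          ∎)
    where open ≡-Reasoning

  ⟦toℕ⟧-+ : ∀ x y → ⟦ toℕ ⟦ x ⟧ + y ⟧ ≡ ⟦ x + y ⟧
  ⟦toℕ⟧-+ x y = begin
    ⟦ toℕ ⟦ x ⟧ + y ⟧  ≡⟨ cong ⟦_⟧ (+-comm (toℕ ⟦ x ⟧) y) ⟩
    ⟦ y + toℕ ⟦ x ⟧ ⟧  ≡⟨ +-congʳ-⟦⟧ y (⟦toℕ⟧ ⟦ x ⟧) ⟩
    ⟦ y + x ⟧          ≡⟨ cong ⟦_⟧ (+-comm y x) ⟩
    ⟦ x + y ⟧          ∎
    where open ≡-Reasoning

  -- `z * pred n` plays the part of -z: together with z it makes the multiple `z * n`.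
  +-cancelˡ-⟦⟧ : ∀ z {x y} → ⟦ z + x ⟧ ≡ ⟦ z + y ⟧ → ⟦ x ⟧ ≡ ⟦ y ⟧
  +-cancelˡ-⟦⟧ z {x} {y} eq = begin
    ⟦ x ⟧                      ≡⟨ ⟦+*⟧ x z ⟨
    ⟦ x + z * n ⟧              ≡⟨ cong ⟦_⟧ (complement x) ⟨
    ⟦ z * pred n + (z + x) ⟧   ≡⟨ +-congʳ-⟦⟧ (z * pred n) eq ⟩
    ⟦ z * pred n + (z + y) ⟧   ≡⟨ cong ⟦_⟧ (complement y) ⟩
    ⟦ y + z * n ⟧              ≡⟨ ⟦+*⟧ y z ⟩
    ⟦ y ⟧                      ∎
    where
    open ≡-Reasoning
    rearrange : ∀ z p x → z * p + (z + x) ≡ x + z * (1 + p)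
    rearrange = solve-∀
    complement : ∀ x → z * pred n + (z + x) ≡ x + z * n
    complement x = trans (rearrange z (pred n) x) (cong (λ w → x + z * w) (suc-pred n))

  ⟦⟧-injective-< : ∀ {x y} → x < n → y < n → ⟦ x ⟧ ≡ ⟦ y ⟧ → x ≡ y
  ⟦⟧-injective-< x<n y<n eq =
    trans (sym (m<n⇒m%n≡m x<n)) (trans (⟦⟧-% eq) (m<n⇒m%n≡m y<n))

-- The lower bound

-- An arc can be recovered from the number of the path that owns it and its position there.
arcs-bound : ∀ {D m a} → PathDecomposition D m →
  (e : Fin a → Digraph.Vertex D × Digraph.Vertex D) → Injective _≡_ _≡_ e →
  (∀ i → uncurry (Digraph.Arc D) (e i)) → a ≤ m * pred (Digraph.order D)
arcs-bound {D} {m} {a} 𝒫 e e-injective e-arc = Fin.injective⇒≤ code-injective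
  where
  open PathDecomposition 𝒫

  owner : ∀ i → ∃! _≡_ λ j → e i ∈ Path.arcs (path j)
  owner i = partitions (e-arc i)

  arcs≤ : ∀ j → length (Path.arcs (path j)) ≤ pred (Digraph.order D)
  arcs≤ j = <⇒≤pred (length-arcs (path j))

  code : Fin a → Fin (m * pred (Digraph.order D))
  code i = combine (proj₁ (owner i)) (Fin.inject≤ (index (proj₁ (proj₂ (owner i)))) (arcs≤ _))

  same-arc : ∀ {j k x y} (x∈ : x ∈ Path.arcs (path j)) (y∈ : y ∈ Path.arcs (path k)) →
             j ≡ k → toℕ (index x∈) ≡ toℕ (index y∈) → x ≡ y
  same-arc x∈ y∈ refl eq = index-injective (setoid _) x∈ y∈ (Fin.toℕ-injective eq)

  code-injective : Injective _≡_ _≡_ code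
  code-injective {i} {j} eq
    with eq₁ , eq₂ ← Fin.combine-injective (proj₁ (owner i)) _ (proj₁ (owner j)) _ eq
    = e-injective (same-arc _ _ eq₁ (trans (sym (Fin.toℕ-inject≤ _ (arcs≤ _)))
        (trans (cong toℕ eq₂) (Fin.toℕ-inject≤ _ (arcs≤ _)))))

module Cayley (r : ℕ) .{{_ : NonZero r}} where

  open Residue (4 * r) {{m*n≢0 4 r}} public

  open Digraph (𝒞₄ r) using (Vertex; Arc) public

  r<4r : r < 4 * r
  r<4r = subst (r <_) (*-comm r 4) (m<m*n r 4 (s≤s (s≤s z≤n)))

  Arc-⟦⟧ : ∀ x s → 1 ≤ s → s ≤ r → Arc ⟦ x ⟧ ⟦ x + s ⟧
  Arc-⟦⟧ x s 1≤s s≤r = fromℕ< s<4r , subst (λ j → 1 ≤ j × j ≤ r) (sym toℕ-s) (1≤s , s≤r) ,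
    trans (sym (⟦toℕ⟧-+ x s)) (cong (λ j → ⟦ toℕ ⟦ x ⟧ + j ⟧) (sym toℕ-s))
    where
    s<4r : s < 4 * r
    s<4r = ≤-<-trans s≤r r<4r
    toℕ-s : toℕ (fromℕ< s<4r) ≡ s
    toℕ-s = Fin.toℕ-fromℕ< s<4r

  head : Vertex → Fin r → Vertex
  head x s = ⟦ toℕ x + suc (toℕ s) ⟧

  head-injective : ∀ x {s t} → head x s ≡ head x t → s ≡ t
  head-injective x {s} {t} eq = Fin.toℕ-injective (suc-injective
    (⟦⟧-injective-< (jump< s) (jump< t) (+-cancelˡ-⟦⟧ (toℕ x) eq)))
    where
    jump< : ∀ (s : Fin r) → suc (toℕ s) < 4 * r
    jump< s = ≤-<-trans (Fin.toℕ<n s) r<4r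

  Arc-head : ∀ x s → Arc x (head x s)
  Arc-head x s = subst (λ y → Arc y (head x s)) (⟦toℕ⟧ x)
    (Arc-⟦⟧ (toℕ x) (suc (toℕ s)) (s≤s z≤n) (Fin.toℕ<n s))

  Arc⇒head : ∀ {x y} → Arc x y → ∃ λ s → y ≡ head x s
  Arc⇒head {x} (s , (1≤s , s≤r) , refl) with toℕ s in eq
  Arc⇒head {x} (s , (1≤s , s≤r) , refl) | suc j =
    fromℕ< s≤r , cong (λ i → ⟦ toℕ x + suc i ⟧) (sym (Fin.toℕ-fromℕ< s≤r))

  pathNumber-lowerBound : ∀ m → PathDecomposition (𝒞₄ r) m → r < m
  pathNumber-lowerBound m 𝒫 = ≰⇒> λ m≤r → contradiction
    (arcs-bound 𝒫 (arc ∘ remQuot {4 * r} r) (λ {i} {j} → arc∘remQuot-injective i j)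
      λ i → uncurry Arc-head (remQuot {4 * r} r i))
    (<⇒≱ (begin-strict
      m * pred (4 * r)  ≤⟨ *-monoˡ-≤ (pred (4 * r)) m≤r ⟩
      r * pred (4 * r)  <⟨ *-monoʳ-< r (≤-reflexive (suc-pred (4 * r) {{m*n≢0 4 r}})) ⟩
      r * (4 * r)       ≡⟨ *-comm r (4 * r) ⟩
      4 * r * r         ∎))
    where
    open ≤-Reasoning
    arc : Vertex × Fin r → Vertex × Vertex
    arc (x , s) = x , head x s
    arc-injective : ∀ a b → arc a ≡ arc b → a ≡ b
    arc-injective (x , s) (y , t) eq with refl ← ,-injectiveˡ eq =
      cong (x ,_) (head-injective x (,-injectiveʳ eq))
    arc∘remQuot-injective : ∀ i j → arc (remQuot {4 * r} r i) ≡ arc (remQuot {4 * r} r j) → i ≡ j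
    arc∘remQuot-injective i j eq = trans (sym (Fin.combine-remQuot {4 * r} r i))
      (trans (cong (uncurry combine) (arc-injective (remQuot {4 * r} r i) (remQuot {4 * r} r j) eq)) (Fin.combine-remQuot {4 * r} r j))

-- Cut translates and the rainbow path

-- The sequence is total, so orbits fit without bounded indices; the path is its initial part with
-- `size` arcs. Membership of an arc then amounts to giving its index.
record IndexedPath (D : Digraph) : Set where
  open Digraph D
  field
    vertex      : ℕ → Vertex
    size        : ℕ
    size>0      : 0 < size
    injective   : ∀ {i j} → i < j → j ≤ size → vertex i ≢ vertex j
    consecutive : ∀ {i} → i < size → Arc (vertex i) (vertex (suc i))

  toPath : Path D
  toPath = record
    { vertices   = applyUpTo vertex (suc size)
    ; nontrivial = subst (2 ≤_) (sym (length-applyUpTo vertex (suc size))) (s≤s size>0)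
    ; simple     = Unique.applyUpTo⁺₁ vertex (suc size) (λ i<j j≤n → injective i<j (s≤s⁻¹ j≤n))
    ; directed   = Linked.applyUpTo⁺₁ vertex (suc size) (consecutive ∘ s≤s⁻¹)
    }

  arc : ℕ → Vertex × Vertex
  arc i = vertex i , vertex (suc i)

  ∈-arcs⁺ : ∀ {i} → i < size → arc i ∈ Path.arcs toPath
  ∈-arcs⁺ i<n = subst (_ ∈_) (sym (consecutive-applyUpTo vertex size)) (∈-applyUpTo⁺ arc i<n)

  ∈-arcs⁻ : ∀ {a} → a ∈ Path.arcs toPath → ∃ λ i → i < size × a ≡ arc i
  ∈-arcs⁻ a∈ = ∈-applyUpTo⁻ arc (subst (_ ∈_) (consecutive-applyUpTo vertex size) a∈)

-- Translation by 2u carries the arc of the functional digraph x ↦ next x that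
-- leaves z to (tail′ z u , head′ z u).  The map sending each arc of 𝒞₄(r) to
-- such a pair (z , u) is injective between sets of size 4r · r, hence bijective.
module Translates (r : ℕ) .{{_ : NonZero r}} (jump : ℕ → ℕ)
  (jump-+ : ∀ x w → jump (x + 2 * r * w) ≡ jump x)
  (jump-surjective : ∀ i (s : Fin r) → i < 2 → ∃ λ m → m < r × jump (i + 2 * m) ≡ suc (toℕ s)) where

  open Cayley r public
  open Walk jump public

  private instance
    4r≢0 : NonZero (4 * r)
    4r≢0 = m*n≢0 4 r

  jump-mod : ∀ x → jump (toℕ ⟦ x ⟧) ≡ jump x
  jump-mod x = begin
    jump (toℕ ⟦ x ⟧)                                   ≡⟨ cong jump (toℕ-⟦⟧ x) ⟩
    jump (x % (4 * r))                                 ≡⟨ jump-+ (x % (4 * r)) (2 * (x / (4 * r))) ⟨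
    jump (x % (4 * r) + 2 * r * (2 * (x / (4 * r))))   ≡⟨ cong (λ y → jump (x % (4 * r) + y)) (e r (x / (4 * r))) ⟩
    jump (x % (4 * r) + x / (4 * r) * (4 * r))         ≡⟨ cong jump (m≡m%n+[m/n]*n x (4 * r)) ⟨
    jump x                                             ∎
    where
    open ≡-Reasoning
    e : ∀ r v → 2 * r * (2 * v) ≡ v * (4 * r)
    e = solve-∀

  next-cong : ∀ {x y} → ⟦ x ⟧ ≡ ⟦ y ⟧ → ⟦ next x ⟧ ≡ ⟦ next y ⟧
  next-cong {x} {y} eq = begin
    ⟦ x + jump x ⟧              ≡⟨ ⟦toℕ⟧-+ x (jump x) ⟨
    ⟦ toℕ ⟦ x ⟧ + jump x ⟧      ≡⟨ cong₂ (λ v j → ⟦ toℕ v + j ⟧) eq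
                                      (trans (sym (jump-mod x)) (trans (cong (jump ∘ toℕ) eq) (jump-mod y))) ⟩
    ⟦ toℕ ⟦ y ⟧ + jump y ⟧      ≡⟨ ⟦toℕ⟧-+ y (jump y) ⟩
    ⟦ y + jump y ⟧              ∎
    where open ≡-Reasoning

  walk-cong : ∀ n {x y} → ⟦ x ⟧ ≡ ⟦ y ⟧ → ⟦ walk n x ⟧ ≡ ⟦ walk n y ⟧
  walk-cong zero    eq = eq
  walk-cong (suc n) eq = next-cong (walk-cong n eq)

  tail′ head′ : Vertex → Fin r → Vertex
  tail′ z u = ⟦ 2 * toℕ u + toℕ z ⟧
  head′ z u = ⟦ 2 * toℕ u + next (toℕ z) ⟧

  tail-⟦⟧ : ∀ z u → tail′ ⟦ z ⟧ u ≡ ⟦ 2 * toℕ u + z ⟧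
  tail-⟦⟧ z u = +-congʳ-⟦⟧ (2 * toℕ u) (⟦toℕ⟧ ⟦ z ⟧)

  head-⟦⟧ : ∀ z u → head′ ⟦ z ⟧ u ≡ ⟦ 2 * toℕ u + next z ⟧
  head-⟦⟧ z u = +-congʳ-⟦⟧ (2 * toℕ u) (next-cong (⟦toℕ⟧ ⟦ z ⟧))

  head′≡ : ∀ z u → head′ z u ≡ ⟦ toℕ (tail′ z u) + jump (toℕ z) ⟧
  head′≡ z u = trans (cong ⟦_⟧ (sym (+-assoc (2 * toℕ u) (toℕ z) _))) (sym (⟦toℕ⟧-+ (2 * toℕ u + toℕ z) _))

  record Located (x : Vertex) (s : Fin r) : Set where
    field
      base      : Vertex
      shift     : Fin r
      tail-base : tail′ base shift ≡ x
      jump-base : jump (toℕ base) ≡ suc (toℕ s)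

  -- The base must be i + 2m modulo 2r, so the shift must be a - m modulo r, written without
  -- subtraction as `d`. The shift takes only r values; what is lost by reducing it goes into `z` as
  -- a multiple of 2r, which the jump does not see.
  module Locate (x m : ℕ) (m≤r : m ≤ r) where
    i a d z : ℕ
    i = x % 2
    a = x / 2
    d = a + (r ∸ m)
    z = i + 2 * m + 2 * r * (1 + d / r)

    sum : 2 * toℕ (d mod r) + z ≡ x + 1 * (4 * r)
    sum = begin
      2 * toℕ (d mod r) + z                        ≡⟨ cong (λ κ → 2 * κ + z) (Fin.toℕ-fromℕ< (m%n<n d r)) ⟩
      2 * (d % r) + z                              ≡⟨ e₁ r (d % r) i m (d / r) ⟩
      i + 2 * m + 2 * (d % r + d / r * r) + 2 * r  ≡⟨ cong (λ y → i + 2 * m + 2 * y + 2 * r) (m≡m%n+[m/n]*n d r) ⟨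
      i + 2 * m + 2 * d + 2 * r                    ≡⟨ e₂ r i m a (r ∸ m) ⟩
      i + a * 2 + 2 * (m + (r ∸ m)) + 2 * r        ≡⟨ cong₂ (λ y l → y + 2 * l + 2 * r) (sym (m≡m%n+[m/n]*n x 2)) (m+[n∸m]≡n m≤r) ⟩
      x + 2 * r + 2 * r                            ≡⟨ e₃ r x ⟩
      x + 1 * (4 * r)                              ∎
      where
      open ≡-Reasoning
      e₁ : ∀ r κ i m w → 2 * κ + (i + 2 * m + 2 * r * (1 + w)) ≡ i + 2 * m + 2 * (κ + w * r) + 2 * r
      e₁ = solve-∀
      e₂ : ∀ r i m a l → i + 2 * m + 2 * (a + l) + 2 * r ≡ i + a * 2 + 2 * (m + l) + 2 * r
      e₂ = solve-∀
      e₃ : ∀ r x → x + 2 * r + 2 * r ≡ x + 1 * (4 * r)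
      e₃ = solve-∀

  locate′ : ∀ x s m → m ≤ r → jump (toℕ x % 2 + 2 * m) ≡ suc (toℕ s) → Located x s
  locate′ x s m m≤r jump≡ = record
    { base      = ⟦ z ⟧
    ; shift     = d mod r
    ; tail-base = trans (tail-⟦⟧ z (d mod r)) (trans (cong ⟦_⟧ sum) (trans (⟦+*⟧ (toℕ x) 1) (⟦toℕ⟧ x)))
    ; jump-base = trans (jump-mod z) (trans (jump-+ (i + 2 * m) (1 + d / r)) jump≡)
    }
    where open Locate (toℕ x) m m≤r

  locate : ∀ x s → Located x s
  locate x s = let m , m<r , jump≡ = jump-surjective (toℕ x % 2) s (m%n<n (toℕ x) 2)
               in locate′ x s m (<⇒≤ m<r) jump≡

  module _ (x : Vertex) (s : Fin r) where
    open Located (locate x s) public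

  head-base : ∀ x s → head′ (base x s) (shift x s) ≡ head x s
  head-base x s = trans (head′≡ (base x s) (shift x s))
    (cong₂ (λ y j → ⟦ toℕ y + j ⟧) (tail-base x s) (jump-base x s))

  located : Vertex × Fin r → Vertex × Fin r
  located (x , s) = base x s , shift x s

  located-injective : ∀ a b → located a ≡ located b → a ≡ b
  located-injective (x , s) (y , t) eq = cong₂ _,_
    (trans (sym (tail-base x s)) (trans (cong (uncurry tail′) eq) (tail-base y t)))
    (Fin.toℕ-injective (suc-injective
      (trans (sym (jump-base x s)) (trans (cong (jump ∘ toℕ ∘ proj₁) eq) (jump-base y t)))))

  located-surjective : ∀ b → ∃ λ a → located a ≡ b
  located-surjective = ×-injective⇒strictlySurjective located located-injective

  module Origin (z : Vertex) (u : Fin r) where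
    origin : Vertex × Fin r
    origin = proj₁ (located-surjective (z , u))

    located-origin : located origin ≡ (z , u)
    located-origin = proj₂ (located-surjective (z , u))

    tail-origin : proj₁ origin ≡ tail′ z u
    tail-origin = trans (sym (tail-base (proj₁ origin) (proj₂ origin))) (cong (uncurry tail′) located-origin)

    head-origin : uncurry head origin ≡ head′ z u
    head-origin = trans (sym (head-base (proj₁ origin) (proj₂ origin))) (cong (uncurry head′) located-origin)

  head-injective₂ : ∀ {x y s t} → x ≡ y → head x s ≡ head y t → (x , s) ≡ (y , t)
  head-injective₂ {x} refl eq = cong (x ,_) (head-injective x eq)

  -- Both pairs are values of `located`, and tail and head together determine its argument.
  translates-disjoint : ∀ z u z′ u′ → tail′ z u ≡ tail′ z′ u′ → head′ z u ≡ head′ z′ u′ → (z , u) ≡ (z′ , u′)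
  translates-disjoint z u z′ u′ tail≡ head≡ =
    trans (sym a.located-origin) (trans (cong located same-origin) b.located-origin)
    where
    module a = Origin z u
    module b = Origin z′ u′
    same-origin : a.origin ≡ b.origin
    same-origin = head-injective₂ (trans a.tail-origin (trans tail≡ (sym b.tail-origin)))
      (trans a.head-origin (trans head≡ (sym b.head-origin)))

  -- Every vertex is the base of some located arc, so its jump is `suc (toℕ s)` for some s in
  -- `Fin r`. The shift 0 is an arbitrary choice.
  jump-bounds : ∀ x → 1 ≤ jump x × jump x ≤ r
  jump-bounds x = subst (λ j → 1 ≤ j × j ≤ r) jump≡ (s≤s z≤n , Fin.toℕ<n (proj₂ origin))
    where
    open Origin ⟦ x ⟧ (0 mod r)
    jump≡ : suc (toℕ (proj₂ origin)) ≡ jump x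
    jump≡ = trans (sym (jump-base (proj₁ origin) (proj₂ origin)))
      (trans (cong (jump ∘ toℕ ∘ proj₁) located-origin) (jump-mod x))

  Arc-next : ∀ a x → Arc ⟦ a + x ⟧ ⟦ a + next x ⟧
  Arc-next a x = subst (λ y → Arc ⟦ a + x ⟧ ⟦ y ⟧) (+-assoc a x (jump x))
    (Arc-⟦⟧ (a + x) (jump x) (proj₁ (jump-bounds x)) (proj₂ (jump-bounds x)))

  -- A walk cannot be reversed, but it can be completed to laps: if a steps lead from 0 to x, then a
  -- * l more make a closed walks of length l + 1 and end at 0.
  transitive : (∀ y → ∃ λ n → ⟦ walk n 0 ⟧ ≡ ⟦ y ⟧) → ∀ {l} → ⟦ walk (suc l) 0 ⟧ ≡ ⟦ 0 ⟧ →
               ∀ x y → ∃ λ n → ⟦ walk n x ⟧ ≡ ⟦ y ⟧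
  transitive reach {l} closed x y = n + a * l , (begin
    ⟦ walk (n + a * l) x ⟧             ≡⟨ cong ⟦_⟧ (walk-+ n (a * l) x) ⟩
    ⟦ walk n (walk (a * l) x) ⟧        ≡⟨ walk-cong n back ⟩
    ⟦ walk n 0 ⟧                       ≡⟨ proj₂ (reach y) ⟩
    ⟦ y ⟧                              ∎)
    where
    open ≡-Reasoning
    a = proj₁ (reach x)
    n = proj₁ (reach y)
    laps : ∀ a → ⟦ walk (a * suc l) 0 ⟧ ≡ ⟦ 0 ⟧
    laps zero    = refl
    laps (suc a) = trans (cong ⟦_⟧ (walk-+ (suc l) (a * suc l) 0)) (trans (walk-cong (suc l) (laps a)) closed)
    back : ⟦ walk (a * l) x ⟧ ≡ ⟦ 0 ⟧
    back = begin
      ⟦ walk (a * l) x ⟧            ≡⟨ walk-cong (a * l) (proj₂ (reach x)) ⟨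
      ⟦ walk (a * l) (walk a 0) ⟧   ≡⟨ cong ⟦_⟧ (walk-+ (a * l) a 0) ⟨
      ⟦ walk (a * l + a) 0 ⟧        ≡⟨ cong (λ i → ⟦ walk i 0 ⟧) (trans (+-comm (a * l) a) (sym (*-suc a l))) ⟩
      ⟦ walk (a * suc l) 0 ⟧        ≡⟨ laps a ⟩
      ⟦ 0 ⟧                         ∎

  ⟦⟧-≡ : ∀ {x y} a b → x + a * (4 * r) ≡ y + b * (4 * r) → ⟦ x ⟧ ≡ ⟦ y ⟧
  ⟦⟧-≡ {x} {y} a b eq = trans (sym (⟦+*⟧ x a)) (trans (cong ⟦_⟧ eq) (⟦+*⟧ y b))

  -- The t-th arc of the rainbow path is the arc leaving cut u in the translate by 2u.
  Rung : (ℕ → ℕ) → (Fin r → ℕ) → ℕ → Fin r → Set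
  Rung rainbow cut t u = ⟦ rainbow t ⟧ ≡ ⟦ 2 * toℕ u + cut u ⟧ ×
                         ⟦ rainbow (suc t) ⟧ ≡ ⟦ 2 * toℕ u + next (cut u) ⟧

  module Rainbow
    (walk-transitive : ∀ x y → ∃ λ n → ⟦ walk n x ⟧ ≡ ⟦ y ⟧)
    (cut : Fin r → ℕ) (rainbow : ℕ → ℕ)
    (rainbow-injective : ∀ {i j} → i < j → j ≤ r → ⟦ rainbow i ⟧ ≢ ⟦ rainbow j ⟧)
    (rung-at : ∀ {t} → t < r → ∃ λ u → Rung rainbow cut t u)
    (rung-of : ∀ u → ∃ λ t → t < r × Rung rainbow cut t u)
    where

    M : ℕ
    M = pred (4 * r)

    M<4r : M < 4 * r
    M<4r = ≤-reflexive (suc-pred (4 * r) {{m*n≢0 4 r}})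

    ≤M⇒<4r : ∀ {i} → i ≤ M → i < 4 * r
    ≤M⇒<4r i≤M = ≤-<-trans i≤M M<4r

    module Cut (u : Fin r) where

      along : ℕ → ℕ
      along n = walk n (next (cut u))

      along-surjective : ∀ x → ∃ λ n → ⟦ along n ⟧ ≡ x
      along-surjective x = let n , eq = walk-transitive (next (cut u)) (toℕ x) in n , trans eq (⟦toℕ⟧ x)

      open Orbit (λ n → ⟦ along n ⟧) next-cong along-surjective public

      -- One step beyond the cut vertex the walk is back at its start, so the cut vertex cannot come
      -- before the orbit is exhausted. Hence it is the last of the 4r vertices, as `along-M`
      -- records.
      along-closes : ∀ {n} → ⟦ along n ⟧ ≡ ⟦ cut u ⟧ → 4 * r ≤ suc n
      along-closes {n} eq = ≮⇒≥ λ n<4r → o-injective-< z<s n<4r (sym (next-cong eq))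

      along-M : ⟦ along M ⟧ ≡ ⟦ cut u ⟧
      along-M = let n , n<4r , eq = o-surjective-< ⟦ cut u ⟧ in
        subst (λ i → ⟦ along i ⟧ ≡ ⟦ cut u ⟧)
          (≤-antisym (<⇒≤pred n<4r) (pred-mono-≤ (along-closes eq))) eq

      indexed : IndexedPath (𝒞₄ r)
      indexed = record
        { vertex      = λ n → ⟦ 2 * toℕ u + along n ⟧
        ; size        = M
        ; size>0      = <⇒≤pred (≤-<-trans (>-nonZero⁻¹ r) r<4r)
        ; injective   = λ i<j j≤M eq → o-injective-< i<j (≤M⇒<4r j≤M) (+-cancelˡ-⟦⟧ (2 * toℕ u) eq)
        ; consecutive = λ {i} _ → Arc-next (2 * toℕ u) (along i)
        }

      open IndexedPath indexed public using (∈-arcs⁺; ∈-arcs⁻) renaming (toPath to cutPath)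

      ∈-cutPath⁺ : ∀ z → z ≢ ⟦ cut u ⟧ → (tail′ z u , head′ z u) ∈ Path.arcs cutPath
      ∈-cutPath⁺ z z≢ with o-surjective-< z
      ... | n , n<4r , refl = subst (_∈ Path.arcs cutPath)
        (sym (cong₂ _,_ (tail-⟦⟧ (along n) u) (head-⟦⟧ (along n) u)))
        (∈-arcs⁺ (≤∧≢⇒< (<⇒≤pred n<4r) λ { refl → z≢ along-M }))

      ∈-cutPath⁻ : ∀ {a} → a ∈ Path.arcs cutPath → ∃ λ z → z ≢ ⟦ cut u ⟧ × a ≡ (tail′ z u , head′ z u)
      ∈-cutPath⁻ a∈ with ∈-arcs⁻ a∈
      ... | n , n<M , refl = ⟦ along n ⟧ ,
        (λ eq → <⇒≱ (<-≤-trans (s<s n<M) M<4r) (along-closes eq)) ,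
        sym (cong₂ _,_ (tail-⟦⟧ (along n) u) (head-⟦⟧ (along n) u))

    rung-tail : ∀ {t u} → Rung rainbow cut t u → (⟦ rainbow t ⟧ , ⟦ rainbow (suc t) ⟧) ≡ (tail′ ⟦ cut u ⟧ u , head′ ⟦ cut u ⟧ u)
    rung-tail {t} {u} (t≡ , st≡) = cong₂ _,_
      (trans t≡ (sym (tail-⟦⟧ (cut u) u))) (trans st≡ (sym (head-⟦⟧ (cut u) u)))

    rainbowIndexed : IndexedPath (𝒞₄ r)
    rainbowIndexed = record
      { vertex      = ⟦_⟧ ∘ rainbow
      ; size        = r
      ; size>0      = >-nonZero⁻¹ r
      ; injective   = rainbow-injective
      ; consecutive = λ t<r → let u , t≡ , st≡ = rung-at t<r in
                        subst₂ Arc (sym t≡) (sym st≡) (Arc-next (2 * toℕ u) (cut u))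
      }

    open IndexedPath rainbowIndexed using (∈-arcs⁺; ∈-arcs⁻) renaming (toPath to rainbowPath)

    paths : Fin (suc r) → Path (𝒞₄ r)
    paths zero    = rainbowPath
    paths (suc u) = Cut.cutPath u

    owner : Vertex → Fin r → Fin (suc r)
    owner z u with z Fin.≟ ⟦ cut u ⟧
    ... | yes _ = zero
    ... | no  _ = suc u

    ∈-owner : ∀ z u → (tail′ z u , head′ z u) ∈ Path.arcs (paths (owner z u))
    ∈-owner z u with z Fin.≟ ⟦ cut u ⟧
    ... | no  z≢   = Cut.∈-cutPath⁺ u z z≢
    ... | yes refl with rung-of u
    ...   | t , t<r , rung = subst (_∈ Path.arcs rainbowPath) (rung-tail rung)
      (∈-arcs⁺ t<r)

    owner-yes : ∀ u → owner ⟦ cut u ⟧ u ≡ zero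
    owner-yes u with ⟦ cut u ⟧ Fin.≟ ⟦ cut u ⟧
    ... | yes _  = refl
    ... | no  ≢  = contradiction refl ≢

    owner-no : ∀ z u → z ≢ ⟦ cut u ⟧ → owner z u ≡ suc u
    owner-no z u z≢ with z Fin.≟ ⟦ cut u ⟧
    ... | yes eq = contradiction eq z≢
    ... | no  _  = refl

    -- This is the uniqueness half: by `translates-disjoint` an arc determines (z , u), and so every
    -- path that contains it is the owner.
    ∈⇒owner : ∀ j {a} → a ∈ Path.arcs (paths j) →
              ∃ λ z → ∃ λ u → a ≡ (tail′ z u , head′ z u) × owner z u ≡ j
    ∈⇒owner zero a∈ with ∈-arcs⁻ a∈
    ... | t , t<r , refl = let u , rung = rung-at t<r in ⟦ cut u ⟧ , u , rung-tail rung , owner-yes u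
    ∈⇒owner (suc u) a∈ = let z , z≢ , eq = Cut.∈-cutPath⁻ u a∈ in z , u , eq , owner-no z u z≢

    decomposition : PathDecomposition (𝒞₄ r) (suc r)
    decomposition = record { path = paths ; partitions = λ arc → partition (Arc⇒head arc) }
      where
      partition : ∀ {x y} → (∃ λ s → y ≡ head x s) → ∃! _≡_ λ i → (x , y) ∈ Path.arcs (paths i)
      partition {x} {y} (s , y≡) = owner z u , subst (_∈ Path.arcs (paths (owner z u))) arc≡ (∈-owner z u) , unique
        where
        z = base x s
        u = shift x s
        arc≡ : (tail′ z u , head′ z u) ≡ (x , y)
        arc≡ = cong₂ _,_ (tail-base x s) (trans (head-base x s) (sym y≡))
        unique : ∀ {j} → (x , y) ∈ Path.arcs (paths j) → owner z u ≡ j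
        unique {j} a∈ = let z′ , u′ , eq , owner≡ = ∈⇒owner j a∈
                            same = trans arc≡ eq
                        in trans (cong (uncurry owner)
                             (translates-disjoint z u z′ u′ (,-injectiveˡ same) (,-injectiveʳ same))) owner≡

-- The table of jumps

infix 4 _[_]=_
-- Unlike an equation for `at`, which is 0 beyond the end of the list, this also certifies that the
-- index is in range.
data _[_]=_ {A : Set} : List A → ℕ → A → Set where
  here  : ∀ {x xs} → x ∷ xs [ 0 ]= x
  there : ∀ {x y xs i} → xs [ i ]= y → x ∷ xs [ suc i ]= y

[]=-++ˡ : ∀ {A : Set} {xs ys : List A} {i x} → xs [ i ]= x → xs ++ ys [ i ]= x
[]=-++ˡ here      = here
[]=-++ˡ (there p) = there ([]=-++ˡ p)

[]=⇒< : ∀ {A : Set} {xs : List A} {i x} → xs [ i ]= x → i < length xs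
[]=⇒< here      = z<s
[]=⇒< (there p) = s<s ([]=⇒< p)

at : List ℕ → ℕ → ℕ
at []       _       = 0
at (x ∷ xs) zero    = x
at (x ∷ xs) (suc i) = at xs i

[]=⇒at : ∀ {xs i x} → xs [ i ]= x → at xs i ≡ x
[]=⇒at here      = refl
[]=⇒at (there p) = []=⇒at p

staircase : ℕ → ℕ → List ℕ
staircase zero    c = []
staircase (suc n) c = c + 4 * n ∷ staircase n c

length-staircase : ∀ n c → length (staircase n c) ≡ n
length-staircase zero    c = refl
length-staircase (suc n) c = cong suc (length-staircase n c)

-- The position t and the height u are two variables with a fixed sum. The block lemmas below keep
-- this form, so that the image of a vertex is a linear expression without subtraction.
staircase-[]= : ∀ c t u → staircase (suc (t + u)) c [ t ]= c + 4 * u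
staircase-[]= c zero    u = here
staircase-[]= c (suc t) u = there (staircase-[]= c t u)

staircase-++ʳ : ∀ n c {xs i x} → xs [ i ]= x → staircase n c ++ xs [ n + i ]= x
staircase-++ʳ zero    c p = p
staircase-++ʳ (suc n) c p = there (staircase-++ʳ n c p)

-- The jumps from the even (row k 0) and odd (row k 1) residues modulo 2r in
-- increasing order, where q = 2 + k.  On each block the jump drops by 4 while
-- the vertex grows by 2, so that next is a reflection x ↦ c − x there.
row : ℕ → ℕ → List ℕ
row k zero    = staircase (3 + k) 1 ++ staircase (1 + k) 6 ++ staircase (2 + k) 4 ++ staircase (2 + k) 3 ++ [ 2 ]
row k (suc _) = staircase (3 + k) 1 ++ staircase (2 + k) 2 ++ staircase (1 + k) 4 ++ [ 8 + 4 * k ] ++ staircase (2 + k) 3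

length-row : ∀ k i → length (row k i) ≡ 9 + 4 * k
length-row k zero
  rewrite length-++ (staircase (3 + k) 1) {staircase (1 + k) 6 ++ staircase (2 + k) 4 ++ staircase (2 + k) 3 ++ [ 2 ]}
        | length-++ (staircase (1 + k) 6) {staircase (2 + k) 4 ++ staircase (2 + k) 3 ++ [ 2 ]}
        | length-++ (staircase (2 + k) 4) {staircase (2 + k) 3 ++ [ 2 ]}
        | length-++ (staircase (2 + k) 3) {[ 2 ]}
        | length-staircase k 1 | length-staircase k 6 | length-staircase k 4 | length-staircase k 3
  = arith k
  where
  arith : ∀ k → 3 + k + (1 + k + (2 + k + (2 + k + 1))) ≡ 9 + 4 * k
  arith = solve-∀
length-row k (suc _)
  rewrite length-++ (staircase (3 + k) 1) {staircase (2 + k) 2 ++ staircase (1 + k) 4 ++ [ 8 + 4 * k ] ++ staircase (2 + k) 3}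
        | length-++ (staircase (2 + k) 2) {staircase (1 + k) 4 ++ [ 8 + 4 * k ] ++ staircase (2 + k) 3}
        | length-++ (staircase (1 + k) 4) {[ 8 + 4 * k ] ++ staircase (2 + k) 3}
        | length-staircase k 1 | length-staircase k 2 | length-staircase k 4 | length-staircase k 3
  = arith k
  where
  arith : ∀ k → 3 + k + (2 + k + (1 + k + (1 + (2 + k)))) ≡ 9 + 4 * k
  arith = solve-∀

module Even where

  block₁ : ∀ k t u → t + u ≡ 2 + k → row k 0 [ t ]= 1 + 4 * u
  block₁ k t u eq = []=-++ˡ (subst (λ n → staircase (suc n) 1 [ t ]= 1 + 4 * u) eq (staircase-[]= 1 t u))

  block₂ : ∀ k t u → t + u ≡ k → row k 0 [ 3 + k + t ]= 6 + 4 * u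
  block₂ k t u refl = staircase-++ʳ (3 + k) 1 ([]=-++ˡ (staircase-[]= 6 t u))

  block₃ : ∀ k t u → t + u ≡ 1 + k → row k 0 [ 3 + k + (1 + k + t) ]= 4 + 4 * u
  block₃ k t u eq = staircase-++ʳ (3 + k) 1 (staircase-++ʳ (1 + k) 6
    ([]=-++ˡ (subst (λ n → staircase (suc n) 4 [ t ]= 4 + 4 * u) eq (staircase-[]= 4 t u))))

  block₄ : ∀ k t u → t + u ≡ 1 + k → row k 0 [ 3 + k + (1 + k + (2 + k + t)) ]= 3 + 4 * u
  block₄ k t u eq = staircase-++ʳ (3 + k) 1 (staircase-++ʳ (1 + k) 6 (staircase-++ʳ (2 + k) 4
    ([]=-++ˡ (subst (λ n → staircase (suc n) 3 [ t ]= 3 + 4 * u) eq (staircase-[]= 3 t u)))))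

  block₅ : ∀ k → row k 0 [ 3 + k + (1 + k + (2 + k + (2 + k + 0))) ]= 2
  block₅ k = staircase-++ʳ (3 + k) 1 (staircase-++ʳ (1 + k) 6 (staircase-++ʳ (2 + k) 4 (staircase-++ʳ (2 + k) 3 here)))

module Odd where

  block₁ : ∀ k t u → t + u ≡ 2 + k → row k 1 [ t ]= 1 + 4 * u
  block₁ k t u eq = []=-++ˡ (subst (λ n → staircase (suc n) 1 [ t ]= 1 + 4 * u) eq (staircase-[]= 1 t u))

  block₂ : ∀ k t u → t + u ≡ 1 + k → row k 1 [ 3 + k + t ]= 2 + 4 * u
  block₂ k t u eq = staircase-++ʳ (3 + k) 1
    ([]=-++ˡ (subst (λ n → staircase (suc n) 2 [ t ]= 2 + 4 * u) eq (staircase-[]= 2 t u)))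

  block₃ : ∀ k t u → t + u ≡ k → row k 1 [ 3 + k + (2 + k + t) ]= 4 + 4 * u
  block₃ k t u refl = staircase-++ʳ (3 + k) 1 (staircase-++ʳ (2 + k) 2 ([]=-++ˡ (staircase-[]= 4 t u)))

  block₄ : ∀ k → row k 1 [ 3 + k + (2 + k + (1 + k + 0)) ]= 8 + 4 * k
  block₄ k = staircase-++ʳ (3 + k) 1 (staircase-++ʳ (2 + k) 2 (staircase-++ʳ (1 + k) 4 here))

  block₅ : ∀ k t u → t + u ≡ 1 + k → row k 1 [ 3 + k + (2 + k + (1 + k + suc t)) ]= 3 + 4 * u
  block₅ k t u eq = staircase-++ʳ (3 + k) 1 (staircase-++ʳ (2 + k) 2 (staircase-++ʳ (1 + k) 4
    (there (subst (λ n → staircase (suc n) 3 [ t ]= 3 + 4 * u) eq (staircase-[]= 3 t u)))))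

module _ (k : ℕ) where
  jump : ℕ → ℕ
  jump x = at (row k (x % 2)) ((x / 2) % (9 + 4 * k))

  open Walk jump public

jump-row : ∀ k {i m j} → i < 2 → row k i [ m ]= j → jump k (i + 2 * m) ≡ j
jump-row k {i} {m} {j} i<2 p = trans (cong₂ at (cong (row k) %2≡) half) ([]=⇒at p)
  where
  x≡ : i + 2 * m ≡ i + m * 2
  x≡ = cong (i +_) (*-comm 2 m)
  %2≡ : (i + 2 * m) % 2 ≡ i
  %2≡ = trans (cong (_% 2) x≡) (trans ([m+kn]%n≡m%n i m 2) (m<n⇒m%n≡m i<2))
  half : ((i + 2 * m) / 2) % (9 + 4 * k) ≡ m
  half = begin
    ((i + 2 * m) / 2) % (9 + 4 * k)      ≡⟨ cong (λ x → (x / 2) % (9 + 4 * k)) x≡ ⟩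
    ((i + m * 2) / 2) % (9 + 4 * k)      ≡⟨ cong (_% (9 + 4 * k)) (+-distrib-/-∣ʳ i (divides m refl)) ⟩
    (i / 2 + m * 2 / 2) % (9 + 4 * k)    ≡⟨ cong₂ (λ x y → (x + y) % (9 + 4 * k)) (m<n⇒m/n≡0 i<2) (m*n/n≡m m 2) ⟩
    m % (9 + 4 * k)                      ≡⟨ m<n⇒m%n≡m (subst (m <_) (length-row k i) ([]=⇒< p)) ⟩
    m                                    ∎
    where open ≡-Reasoning

jump-+ : ∀ k x w → jump k (x + (18 + 8 * k) * w) ≡ jump k x
jump-+ k x w = cong₂ at
  (cong (row k) (trans (cong (_% 2) x+≡) ([m+kn]%n≡m%n x (w * (9 + 4 * k)) 2)))
  (trans (cong (_% (9 + 4 * k)) (trans (cong (_/ 2) x+≡)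
     (trans (+-distrib-/-∣ʳ x (divides (w * (9 + 4 * k)) refl)) (cong (x / 2 +_) (m*n/n≡m (w * (9 + 4 * k)) 2)))))
     ([m+kn]%n≡m%n (x / 2) w (9 + 4 * k)))
  where
  halves : ∀ k w → (18 + 8 * k) * w ≡ (w * (9 + 4 * k)) * 2
  halves = solve-∀
  x+≡ : x + (18 + 8 * k) * w ≡ x + (w * (9 + 4 * k)) * 2
  x+≡ = cong (x +_) (halves k w)

next-+ : ∀ k x w → next k (x + (18 + 8 * k) * w) ≡ next k x + (18 + 8 * k) * w
next-+ k x w = trans (cong (x + (18 + 8 * k) * w +_) (jump-+ k x w)) (arith x _ (jump k x))
  where
  arith : ∀ a b c → a + b + c ≡ a + c + b
  arith = solve-∀

-- Strands and turns of the base cycle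

infix 4 _⊢_⟶_
_⊢_⟶_ : ℕ → ℕ → ℕ → Set
k ⊢ x ⟶ y = ∃ λ n → walk k n x ≡ y

⟶-refl : ∀ {k x} → k ⊢ x ⟶ x
⟶-refl = 0 , refl

infixr 5 _⟫_
_⟫_ : ∀ {k x y z} → k ⊢ x ⟶ y → k ⊢ y ⟶ z → k ⊢ x ⟶ z
_⟫_ {k} {x} (m , refl) (n , eq) = n + m , trans (walk-+ k n m x) eq

walk-shift : ∀ k n x w → walk k n (x + (18 + 8 * k) * w) ≡ walk k n x + (18 + 8 * k) * w
walk-shift k zero    x w = refl
walk-shift k (suc n) x w = trans (cong (next k) (walk-shift k n x w)) (next-+ k (walk k n x) w)

⟶-shift : ∀ {k x y} w → k ⊢ x ⟶ y → k ⊢ x + (18 + 8 * k) * w ⟶ y + (18 + 8 * k) * w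
⟶-shift {k} {x} w (n , refl) = n , walk-shift k n x w

infixr 5 _⟫⟨_⟩_
_⟫⟨_⟩_ : ∀ {k x y y′ z} → k ⊢ x ⟶ y → y ≡ y′ → k ⊢ y′ ⟶ z → k ⊢ x ⟶ z
p ⟫⟨ refl ⟩ q = p ⟫ q

infix 6 _↝_
_↝_ : ∀ {k x y y′} → k ⊢ x ⟶ y → y ≡ y′ → k ⊢ x ⟶ y′
p ↝ refl = p

step : ∀ {k} i {m j} → i < 2 → row k i [ m ]= j → k ⊢ i + 2 * m ⟶ i + 2 * m + j
step {k} i {m} i<2 p = 1 , cong (i + 2 * m +_) (jump-row k i<2 p)

even : ∀ {k m j} → row k 0 [ m ]= j → k ⊢ 2 * m ⟶ 2 * m + j
even = step 0 (s≤s z≤n)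

odd : ∀ {k m j} → row k 1 [ m ]= j → k ⊢ 1 + 2 * m ⟶ 1 + 2 * m + j
odd = step 1 (s≤s (s≤s z≤n))

-- The four blocks visited reflect an even vertex below 2q back to itself plus 4,
-- one turn around ℤ/2r later; below, odd vertices descend by 4 in the same way.
up : ∀ k t u → t + u ≡ k → k ⊢ 2 * t ⟶ 2 * (2 + t) + (18 + 8 * k) * 1
up k t u refl =
  even (Even.block₁ k t (2 + u) (e₀ t u))                    ⟫⟨ e₁ t u ⟩
  odd (Odd.block₂ k (1 + u) t (cong suc (+-comm u t)))        ⟫⟨ e₂ t u ⟩
  odd (Odd.block₃ k t u refl)                                ⟫⟨ e₃ t u ⟩
  odd (Odd.block₅ k u (1 + t) (trans (+-suc u t) (cong suc (+-comm u t)))) ↝ e₄ t u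
  where
  e₀ : ∀ t u → t + (2 + u) ≡ 2 + (t + u)
  e₀ = solve-∀
  e₁ : ∀ t u → 2 * t + (1 + 4 * (2 + u)) ≡ 1 + 2 * (3 + (t + u) + (1 + u))
  e₁ = solve-∀
  e₂ : ∀ t u → 1 + 2 * (3 + (t + u) + (1 + u)) + (2 + 4 * t) ≡ 1 + 2 * (3 + (t + u) + (2 + (t + u) + t))
  e₂ = solve-∀
  e₃ : ∀ t u → 1 + 2 * (3 + (t + u) + (2 + (t + u) + t)) + (4 + 4 * u) ≡
               1 + 2 * (3 + (t + u) + (2 + (t + u) + (1 + (t + u) + (1 + u))))
  e₃ = solve-∀
  e₄ : ∀ t u → 1 + 2 * (3 + (t + u) + (2 + (t + u) + (1 + (t + u) + (1 + u)))) + (3 + 4 * (1 + t)) ≡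
               2 * (2 + t) + (18 + 8 * (t + u)) * 1
  e₄ = solve-∀

down : ∀ k t u → t + u ≡ k → k ⊢ 1 + 2 * (2 + t) ⟶ 1 + 2 * t + (18 + 8 * k) * 1
down k t u refl =
  odd (Odd.block₁ k (2 + t) u refl)                          ⟫⟨ e₁ t u ⟩
  even (Even.block₂ k u t (+-comm u t))                      ⟫⟨ refl ⟩
  skip t u                                                   ⟫
  even (Even.block₄ k u (1 + t) (trans (+-suc u t) (cong suc (+-comm u t)))) ↝ e₄ t u
  where
  e₁ : ∀ t u → 1 + 2 * (2 + t) + (1 + 4 * u) ≡ 2 * (3 + (t + u) + u)
  e₁ = solve-∀
  e₂ : ∀ t → 2 * (3 + (t + 0) + 0) + (6 + 4 * t) ≡ 2 * (3 + (t + 0) + (1 + (t + 0) + (2 + (t + 0) + 0)))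
  e₂ = solve-∀
  e₃ : ∀ t u → 2 * (3 + (t + (1 + u)) + (1 + u)) + (6 + 4 * t) ≡
               2 * (3 + (t + (1 + u)) + (1 + (t + (1 + u)) + (2 + t)))
  e₃ = solve-∀
  e₃′ : ∀ t u → 2 * (3 + (t + (1 + u)) + (1 + (t + (1 + u)) + (2 + t))) + (4 + 4 * u) ≡
                2 * (3 + (t + (1 + u)) + (1 + (t + (1 + u)) + (2 + (t + (1 + u)) + (1 + u))))
  e₃′ = solve-∀
  e₄ : ∀ t u → 2 * (3 + (t + u) + (1 + (t + u) + (2 + (t + u) + u))) + (3 + 4 * (1 + t)) ≡
               1 + 2 * t + (18 + 8 * (t + u)) * 1
  e₄ = solve-∀
  -- For u = 0 the vertex lies just beyond even block 3, where continuing the progression would give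
  -- jump 0: it is already the vertex of block 4 to which the reflection would lead.
  skip : ∀ t u → t + u ⊢ 2 * (3 + (t + u) + u) + (6 + 4 * t) ⟶
                         2 * (3 + (t + u) + (1 + (t + u) + (2 + (t + u) + u)))
  skip t zero    = ⟶-refl ↝ e₂ t
  skip t (suc u) = move (e₃ t u) (even (Even.block₃ (t + suc u) (2 + t) u (cong suc (sym (+-suc t u))))) (e₃′ t u)
    where
    move : ∀ {k x x′ y y′} → x ≡ x′ → k ⊢ x′ ⟶ y → y ≡ y′ → k ⊢ x ⟶ y′
    move refl p refl = p

-- At this end of an even strand the third vertex falls just past odd block 3, onto the singleton
-- jump 4q. That one jump replaces the last two reflections of `up`, and three steps change the
-- parity of the vertex.
turn₁ : ∀ k → k ⊢ 2 * (1 + k) ⟶ 1 + 2 * (1 + k) + (18 + 8 * k) * 1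
turn₁ k =
  even (Even.block₁ k (1 + k) 1 (+-comm (1 + k) 1)) ⟫⟨ e₁ k ⟩
  odd (Odd.block₂ k 0 (1 + k) refl)               ⟫⟨ e₂ k ⟩
  odd (Odd.block₄ k)                              ↝ e₃ k
  where
  e₁ : ∀ k → 2 * (1 + k) + 5 ≡ 1 + 2 * (3 + k + 0)
  e₁ = solve-∀
  e₂ : ∀ k → 1 + 2 * (3 + k + 0) + (2 + 4 * (1 + k)) ≡ 1 + 2 * (3 + k + (2 + k + (1 + k + 0)))
  e₂ = solve-∀
  e₃ : ∀ k → 1 + 2 * (3 + k + (2 + k + (1 + k + 0))) + (8 + 4 * k) ≡ 1 + 2 * (1 + k) + (18 + 8 * k) * 1
  e₃ = solve-∀

turn₂ : ∀ k → k ⊢ 2 * (2 + k) ⟶ 1 + 2 * (2 + k)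
turn₂ k = even (Even.block₁ k (2 + k) 0 (+-identityʳ (2 + k))) ↝ +-comm (2 * (2 + k)) 1

turn₃ : ∀ k → k ⊢ 1 ⟶ 2 + (18 + 8 * k) * 1
turn₃ k =
  odd (Odd.block₁ k 0 (2 + k) refl)                ⟫⟨ e₁ k ⟩
  even (Even.block₃ k 1 k refl)                    ⟫⟨ e₂ k ⟩
  even (Even.block₄ k (1 + k) 0 (+-identityʳ _))    ⟫⟨ e₃ k ⟩
  odd (Odd.block₅ k (1 + k) 0 (+-identityʳ _))      ↝ e₄ k
  where
  e₁ : ∀ k → 1 + (1 + 4 * (2 + k)) ≡ 2 * (3 + k + (1 + k + 1))
  e₁ = solve-∀
  e₂ : ∀ k → 2 * (3 + k + (1 + k + 1)) + (4 + 4 * k) ≡ 2 * (3 + k + (1 + k + (2 + k + (1 + k))))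
  e₂ = solve-∀
  e₃ : ∀ k → 2 * (3 + k + (1 + k + (2 + k + (1 + k)))) + 3 ≡ 1 + 2 * (3 + k + (2 + k + (1 + k + (2 + k))))
  e₃ = solve-∀
  e₄ : ∀ k → 1 + 2 * (3 + k + (2 + k + (1 + k + (2 + k)))) + 3 ≡ 2 + (18 + 8 * k) * 1
  e₄ = solve-∀

turn₄ : ∀ k → k ⊢ 3 ⟶ (18 + 8 * k) * 1
turn₄ k =
  odd (Odd.block₁ k 1 (1 + k) refl)   ⟫⟨ e₁ k ⟩
  even (Even.block₃ k 0 (1 + k) refl) ⟫⟨ e₂ k ⟩
  even (Even.block₅ k)                ↝ e₃ k
  where
  e₁ : ∀ k → 3 + (1 + 4 * (1 + k)) ≡ 2 * (3 + k + (1 + k + 0))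
  e₁ = solve-∀
  e₂ : ∀ k → 2 * (3 + k + (1 + k + 0)) + (4 + 4 * (1 + k)) ≡ 2 * (3 + k + (1 + k + (2 + k + (2 + k + 0))))
  e₂ = solve-∀
  e₃ : ∀ k → 2 * (3 + k + (1 + k + (2 + k + (2 + k + 0)))) + 2 ≡ (18 + 8 * k) * 1
  e₃ = solve-∀

-- A walk to y that winds w more times around ℤ/2r.
infix 4 _⊢_⟶[_]_
record _⊢_⟶[_]_ (k x w y : ℕ) : Set where
  constructor winding
  field
    unwind : k ⊢ x ⟶ y + (18 + 8 * k) * w

infixr 5 _∙_
_∙_ : ∀ {k x y z v w} → k ⊢ x ⟶[ v ] y → k ⊢ y ⟶[ w ] z → k ⊢ x ⟶[ v + w ] z
_∙_ {k} {x} {y} {z} {v} {w} (winding p) (winding q) = winding (p ⟫ ⟶-shift v q ↝ e (18 + 8 * k) z v w)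
  where
  e : ∀ a z v w → z + a * w + a * v ≡ z + a * (v + w)
  e = solve-∀

unwound : ∀ {k x y} → k ⊢ x ⟶ y → k ⊢ x ⟶[ 0 ] y
unwound {k} {x} {y} p = winding (p ↝ sym (trans (cong (y +_) (*-zeroʳ (18 + 8 * k))) (+-identityʳ y)))

stay : ∀ {k x y} → x ≡ y → k ⊢ x ⟶[ 0 ] y
stay refl = unwound ⟶-refl

double-suc : ∀ t n → t + 2 * suc n ≡ 2 + (t + 2 * n)
double-suc = solve-∀

ups : ∀ k t n u → t + 2 * n + u ≡ 2 + k → k ⊢ 2 * t ⟶[ n ] 2 * (t + 2 * n)
ups k t zero    u eq = stay (cong (2 *_) (sym (+-identityʳ t)))
ups k t (suc n) u eq = subst (λ y → k ⊢ 2 * t ⟶[ suc n ] 2 * y) (sym (double-suc t n))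
  (winding (up k t (2 * n + u) (trans (sym (+-assoc t (2 * n) u)) (suc-injective (suc-injective eq′)))) ∙
   ups k (2 + t) n u eq′)
  where
  eq′ : 2 + (t + 2 * n + u) ≡ 2 + k
  eq′ = trans (cong (_+ u) (sym (double-suc t n))) eq

downs : ∀ k t n u → t + 2 * n + u ≡ 2 + k → k ⊢ 1 + 2 * (t + 2 * n) ⟶[ n ] 1 + 2 * t
downs k t zero    u eq = stay (cong (λ x → 1 + 2 * x) (+-identityʳ t))
downs k t (suc n) u eq = subst (λ y → k ⊢ 1 + 2 * y ⟶[ suc n ] 1 + 2 * t) (sym (double-suc t n))
  (winding (down k (t + 2 * n) u (suc-injective (suc-injective eq′))) ∙
   downs k t n (2 + u) (trans (+-suc (t + 2 * n) (suc u)) (trans (cong suc (+-suc (t + 2 * n) u)) eq′)))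
  where
  eq′ : 2 + (t + 2 * n + u) ≡ 2 + k
  eq′ = trans (cong (_+ u) (sym (double-suc t n))) eq

-- Reachability modulo 2r

Reached : ℕ → ℕ → Set
Reached k x = ∃ λ w → k ⊢ 0 ⟶[ w ] x

reached-step : ∀ {k x v y} → Reached k x → k ⊢ x ⟶[ v ] y → Reached k y
reached-step (w , p) q = w + _ , p ∙ q

halve : ∀ n → (∃ λ p → 2 * p ≡ n) ⊎ (∃ λ p → 1 + 2 * p ≡ n)
halve zero    = inj₁ (0 , refl)
halve (suc n) with halve n
... | inj₁ (p , refl) = inj₂ (p , refl)
... | inj₂ (p , refl) = inj₁ (suc p , *-suc 2 p)

-- The ascending even and descending odd strands modulo 4 are joined at the ends
-- by turn₁, …, turn₄; the order in which they are met depends on the parity of q.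
record Lap (k : ℕ) : Set where
  field
    half-turns    : ℕ
    lap           : k ⊢ 0 ⟶[ 1 + 2 * half-turns ] 0
    reached-2     : Reached k 2
    reached-2q∸1  : Reached k (1 + 2 * (1 + k))
    reached-2q+1  : Reached k (1 + 2 * (2 + k))

lap-even : ∀ p → Lap (2 * p)
lap-even p = record
  -- This is q, in agreement with the winding number 2q + 1 that the sum of the jumps predicts.
  { half-turns   = 2 + 2 * p
  ; lap          = subst (λ w → 2 * p ⊢ 0 ⟶[ w ] 0) (windings p)
                     (to-2q+1 ∙ to-2 ∙ to-2q∸1 ∙ to-0)
  ; reached-2    = _ , to-2q+1 ∙ to-2
  ; reached-2q∸1 = _ , to-2q+1 ∙ to-2 ∙ to-2q∸1
  ; reached-2q+1 = _ , to-2q+1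
  }
  where
  k = 2 * p
  windings : ∀ p → 1 + p + 0 + (1 + p + 1 + (p + 1 + (p + 1))) ≡ 1 + 2 * (2 + 2 * p)
  windings = solve-∀
  to-2q+1 : k ⊢ 0 ⟶[ 1 + p + 0 ] 1 + 2 * (2 + k)
  to-2q+1 = subst (λ y → k ⊢ 0 ⟶[ 1 + p ] 2 * y) (*-suc 2 p)
              (ups k 0 (1 + p) 0 (trans (+-identityʳ _) (*-suc 2 p)))
            ∙ unwound (turn₂ k)
  to-2 : k ⊢ 1 + 2 * (2 + k) ⟶[ 1 + p + 1 ] 2
  to-2 = subst (λ y → k ⊢ 1 + 2 * y ⟶[ 1 + p ] 1) (*-suc 2 p)
           (downs k 0 (1 + p) 0 (trans (+-identityʳ _) (*-suc 2 p)))
         ∙ winding (turn₃ k)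
  to-2q∸1 : k ⊢ 2 ⟶[ p + 1 ] 1 + 2 * (1 + k)
  to-2q∸1 = ups k 1 p 1 (+-comm (1 + k) 1) ∙ winding (turn₁ k)
  to-0 : k ⊢ 1 + 2 * (1 + k) ⟶[ p + 1 ] 0
  to-0 = downs k 1 p 1 (+-comm (1 + k) 1) ∙ winding (turn₄ k)

lap-odd : ∀ p → Lap (1 + 2 * p)
lap-odd p = record
  { half-turns   = 3 + 2 * p
  ; lap          = subst (λ w → k ⊢ 0 ⟶[ w ] 0) (windings p)
                     (to-2q∸1 ∙ to-2 ∙ to-2q+1 ∙ to-0)
  ; reached-2    = _ , to-2q∸1 ∙ to-2
  ; reached-2q∸1 = _ , to-2q∸1
  ; reached-2q+1 = _ , to-2q∸1 ∙ to-2 ∙ to-2q+1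
  }
  where
  k = 1 + 2 * p
  windings : ∀ p → 1 + p + 1 + (1 + p + 1 + (1 + p + 0 + (1 + p + 1))) ≡ 1 + 2 * (3 + 2 * p)
  windings = solve-∀
  short : 2 * (1 + p) ≡ 1 + k
  short = *-suc 2 p
  to-2q∸1 : k ⊢ 0 ⟶[ 1 + p + 1 ] 1 + 2 * (1 + k)
  to-2q∸1 = subst (λ y → k ⊢ 0 ⟶[ 1 + p ] 2 * y) short
              (ups k 0 (1 + p) 1 (trans (+-comm _ 1) (cong suc short)))
            ∙ winding (turn₁ k)
  to-2 : k ⊢ 1 + 2 * (1 + k) ⟶[ 1 + p + 1 ] 2
  to-2 = subst (λ y → k ⊢ 1 + 2 * y ⟶[ 1 + p ] 1) short
           (downs k 0 (1 + p) 1 (trans (+-comm _ 1) (cong suc short)))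
         ∙ winding (turn₃ k)
  to-2q+1 : k ⊢ 2 ⟶[ 1 + p + 0 ] 1 + 2 * (2 + k)
  to-2q+1 = subst (λ y → k ⊢ 2 ⟶[ 1 + p ] 2 * (1 + y)) short
              (ups k 1 (1 + p) 0 (trans (+-identityʳ _) (cong suc short)))
            ∙ unwound (turn₂ k)
  to-0 : k ⊢ 1 + 2 * (2 + k) ⟶[ 1 + p + 1 ] 0
  to-0 = subst (λ y → k ⊢ 1 + 2 * (1 + y) ⟶[ 1 + p ] 3) short
           (downs k 1 (1 + p) 0 (trans (+-identityʳ _) (cong suc short)))
         ∙ winding (turn₄ k)

lap : ∀ k → Lap k
lap k with halve k
... | inj₁ (p , refl) = lap-even p
... | inj₂ (p , refl) = lap-odd p

reached-next : ∀ {k} i {m j y} → i < 2 → row k i [ m ]= j → Reached k (i + 2 * m) → i + 2 * m + j ≡ y → Reached k y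
reached-next i i<2 p r refl = reached-step r (unwound (step i i<2 p))

reached-from-even : ∀ {k m j y} → row k 0 [ m ]= j → Reached k (2 * m) → 2 * m + j ≡ y → Reached k y
reached-from-even = reached-next 0 (s≤s z≤n)

reached-from-odd : ∀ {k m j y} → row k 1 [ m ]= j → Reached k (1 + 2 * m) → 1 + 2 * m + j ≡ y → Reached k y
reached-from-odd = reached-next 1 (s≤s (s≤s z≤n))

-- Peels off an initial block of n + 1 indices. The complement t of m is passed along because the
-- block lemmas speak of both.
by-block : ∀ (P : ℕ → Set) n → (∀ t m → t + m ≡ n → P m) → (∀ m → P (suc n + m)) → ∀ m → P m
by-block P n below above m with m ≤? n
... | yes m≤n = below (n ∸ m) m (m∸n+n≡m m≤n)
... | no  m≰n = subst P (m+[n∸m]≡n (≰⇒> m≰n)) (above (m ∸ suc n))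

module Reaching (k : ℕ) where
  open Lap (lap k)

  -- The two ascending strands start at 0 and at 2; the parity of t selects one.
  low-even : ∀ t u → t + u ≡ 2 + k → Reached k (2 * t)
  low-even t u eq with halve t
  ... | inj₁ (p , refl) = p , ups k 0 p u eq
  ... | inj₂ (p , refl) = reached-step reached-2 (ups k 1 p u eq)

  -- Odd strands descend, so the parity of u, the distance from the top index, decides between the
  -- starting points 2q + 1 and 2q - 1.
  low-odd : ∀ t u → t + u ≡ 2 + k → Reached k (1 + 2 * t)
  low-odd t u eq with halve u
  ... | inj₁ (p , refl) = reached-step reached-2q+1
    (subst (λ y → k ⊢ 1 + 2 * y ⟶[ p ] 1 + 2 * t) eq (downs k t p 0 (trans (+-identityʳ _) eq)))
  ... | inj₂ (p , refl) = reached-step reached-2q∸1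
    (subst (λ y → k ⊢ 1 + 2 * y ⟶[ p ] 1 + 2 * t) (suc-injective eq′)
      (downs k t p 1 (trans (+-comm _ 1) eq′)))
    where
    eq′ : suc (t + 2 * p) ≡ 2 + k
    eq′ = trans (sym (+-suc t (2 * p))) eq

  -- Every remaining vertex is the image of one treated before it.
  even₂ : ∀ t u → t + u ≡ 2 + k → Reached k (2 * (3 + k + u))
  even₂ t u eq = reached-from-odd (Odd.block₁ k t u eq)
    (low-odd t u eq)
    (trans (e t u) (cong (λ x → 2 * (1 + x + u)) eq))
    where
    e : ∀ t u → 1 + 2 * t + (1 + 4 * u) ≡ 2 * (1 + (t + u) + u)
    e = solve-∀

  even₃ : ∀ t u → t + u ≡ k → Reached k (2 * (3 + k + (3 + k + u)))
  even₃ t u eq = reached-from-even (Even.block₂ k t u eq)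
    (even₂ (2 + u) t (cong (2 +_) (trans (+-comm u t) eq)))
    (trans (e k t u) (cong (λ x → 2 * (3 + k + (3 + x + u))) eq))
    where
    e : ∀ k t u → 2 * (3 + k + t) + (6 + 4 * u) ≡ 2 * (3 + k + (3 + (t + u) + u))
    e = solve-∀

  even₄ : ∀ t u → t + u ≡ 1 + k → Reached k (2 * (3 + k + (3 + k + (1 + k + u))))
  even₄ t u eq = reached-from-even (Even.block₃ k t u eq)
    (source t eq)
    (trans (e k t u) (trans (cong (λ x → 2 * (3 + k + (2 + k + (1 + x + u)))) eq) (e′ k u)))
    where
    e : ∀ k t u → 2 * (3 + k + (1 + k + t)) + (4 + 4 * u) ≡ 2 * (3 + k + (2 + k + (1 + (t + u) + u)))
    e = solve-∀
    e′ : ∀ k u → 2 * (3 + k + (2 + k + (1 + (1 + k) + u))) ≡ 2 * (3 + k + (3 + k + (1 + k + u)))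
    e′ = solve-∀
    e″ : ∀ k t → 3 + k + t ≡ 1 + k + (2 + t)
    e″ = solve-∀
    -- The images found so far do not match the blocks of the table: the first two vertices of even
    -- block 3 come from `even₂`, the others from `even₃`.
    source : ∀ t → t + u ≡ 1 + k → Reached k (2 * (3 + k + (1 + k + t)))
    source zero          _  = subst (λ y → Reached k (2 * (3 + k + y)))
      (sym (+-identityʳ (1 + k))) (even₂ 1 (1 + k) refl)
    source (suc zero)    _  = subst (λ y → Reached k (2 * (3 + k + y)))
      (+-comm 1 (1 + k)) (even₂ 0 (2 + k) refl)
    source (suc (suc t)) eq = subst (λ y → Reached k (2 * (3 + k + y)))
      (e″ k t) (even₃ (1 + u) t (trans (+-comm (1 + u) t) (trans (+-suc t u) (suc-injective eq))))

  odd₂ : ∀ t u → t + u ≡ 1 + k → Reached k (1 + 2 * (3 + k + u))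
  odd₂ t u eq = reached-from-even (Even.block₁ k t (1 + u) eq′)
    (low-even t (1 + u) eq′)
    (trans (e t u) (cong (λ x → 1 + 2 * (2 + x + u)) eq))
    where
    eq′ : t + (1 + u) ≡ 2 + k
    eq′ = trans (+-suc t u) (cong suc eq)
    e : ∀ t u → 2 * t + (1 + 4 * (1 + u)) ≡ 1 + 2 * (2 + (t + u) + u)
    e = solve-∀

  odd₃ : ∀ t u → t + u ≡ 1 + k → Reached k (1 + 2 * (3 + k + (2 + k + u)))
  odd₃ t u eq = reached-from-odd (Odd.block₂ k t u eq)
    (odd₂ u t (trans (+-comm u t) eq))
    (trans (e k t u) (cong (λ x → 1 + 2 * (3 + k + (1 + x + u))) eq))
    where
    e : ∀ k t u → 1 + 2 * (3 + k + t) + (2 + 4 * u) ≡ 1 + 2 * (3 + k + (1 + (t + u) + u))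
    e = solve-∀

  odd₄ : ∀ t u → t + u ≡ k → Reached k (1 + 2 * (3 + k + (2 + k + (2 + k + u))))
  odd₄ t u eq = reached-from-odd (Odd.block₃ k t u eq)
    (odd₃ (1 + u) t (cong suc (trans (+-comm u t) eq)))
    (trans (e k t u) (cong (λ x → 1 + 2 * (3 + k + (2 + k + (2 + x + u)))) eq))
    where
    e : ∀ k t u → 1 + 2 * (3 + k + (2 + k + t)) + (4 + 4 * u) ≡ 1 + 2 * (3 + k + (2 + k + (2 + (t + u) + u)))
    e = solve-∀

  -- The odd images so far leave out only 2r - 1, the image of the last vertex of even block 4.
  odd₅ : Reached k (1 + 2 * (3 + k + (2 + k + (2 + k + (1 + k + 0)))))
  odd₅ = reached-from-even (Even.block₄ k (1 + k) 0 (+-identityʳ _))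
    (subst (Reached k) (e k) (even₄ 1 k refl)) (e′ k)
    where
    e : ∀ k → 2 * (3 + k + (3 + k + (1 + k + k))) ≡ 2 * (3 + k + (1 + k + (2 + k + (1 + k))))
    e = solve-∀
    e′ : ∀ k → 2 * (3 + k + (1 + k + (2 + k + (1 + k)))) + 3 ≡ 1 + 2 * (3 + k + (2 + k + (2 + k + (1 + k + 0))))
    e′ = solve-∀

  Reachedᵉ Reachedᵒ : ℕ → Set
  Reachedᵉ m = m < 9 + 4 * k → Reached k (2 * m)
  Reachedᵒ m = m < 9 + 4 * k → Reached k (1 + 2 * m)

  reached-even : ∀ m → Reachedᵉ m
  reached-even =
    by-block Reachedᵉ (2 + k) (λ t m eq _ → low-even m t (trans (+-comm m t) eq))
    (by-block (λ m → Reachedᵉ (3 + k + m)) (2 + k) (λ t m eq _ → even₂ t m eq)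
    (by-block (λ m → Reachedᵉ (3 + k + (3 + k + m))) k (λ t m eq _ → even₃ t m eq)
    (by-block (λ m → Reachedᵉ (3 + k + (3 + k + (1 + k + m)))) (1 + k) (λ t m eq _ → even₄ t m eq)
    λ m m<r → contradiction m<r (m+n≮m (9 + 4 * k) m ∘ subst (_< 9 + 4 * k) (e k m)))))
    where
    e : ∀ k m → 3 + k + (3 + k + (1 + k + (2 + k + m))) ≡ 9 + 4 * k + m
    e = solve-∀

  reached-odd : ∀ m → Reachedᵒ m
  reached-odd =
    by-block Reachedᵒ (2 + k) (λ t m eq _ → low-odd m t (trans (+-comm m t) eq))
    (by-block (λ m → Reachedᵒ (3 + k + m)) (1 + k) (λ t m eq _ → odd₂ t m eq)
    (by-block (λ m → Reachedᵒ (3 + k + (2 + k + m))) (1 + k) (λ t m eq _ → odd₃ t m eq)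
    (by-block (λ m → Reachedᵒ (3 + k + (2 + k + (2 + k + m)))) k (λ t m eq _ → odd₄ t m eq)
    (by-block (λ m → Reachedᵒ (3 + k + (2 + k + (2 + k + (1 + k + m))))) 0 last
    λ m m<r → contradiction m<r (m+n≮m (9 + 4 * k) m ∘ subst (_< 9 + 4 * k) (e k m))))))
    where
    last : ∀ t m → t + m ≡ 0 → Reachedᵒ (3 + k + (2 + k + (2 + k + (1 + k + m))))
    last t m eq _ = subst (λ m → Reached k (1 + 2 * (3 + k + (2 + k + (2 + k + (1 + k + m))))))
      (sym (m+n≡0⇒n≡0 t eq)) odd₅
    e : ∀ k m → 3 + k + (2 + k + (2 + k + (1 + k + (1 + m)))) ≡ 9 + 4 * k + m
    e = solve-∀

-- Every jump occurs in each row

[]=⇒∃ : ∀ {A : Set} {xs : List A} {i x y} → xs [ i ]= x → x ≡ y → ∃ λ j → xs [ j ]= y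
[]=⇒∃ {i = i} p refl = i , p

-- The residue of the jump modulo 4 selects a staircase and the quotient the place in it. Two jumps
-- stand outside their staircases as singletons: 2 in the even row and 4q in the odd row.
row-surjective : ∀ k i s → i < 2 → s < 9 + 4 * k → ∃ λ m → row k i [ m ]= suc s
row-surjective k i s i<2 s<r with s divMod 4
row-surjective k i s i<2 s<r | result u zero eq = case-1 i i<2
  where
  u≤ : u ≤ 2 + k
  u≤ = *-cancelʳ-≤ u (2 + k) 4 (≤-trans (≤-reflexive (sym eq)) (≤-trans (s≤s⁻¹ s<r) (≤-reflexive (e k))))
    where
    e : ∀ k → 8 + 4 * k ≡ (2 + k) * 4
    e = solve-∀
  case-1 : ∀ i → i < 2 → ∃ λ m → row k i [ m ]= suc s
  case-1 0 _ = []=⇒∃ (Even.block₁ k (2 + k ∸ u) u (m∸n+n≡m u≤)) (cong suc (trans (*-comm 4 u) (sym eq)))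
  case-1 1 _ = []=⇒∃ (Odd.block₁ k (2 + k ∸ u) u (m∸n+n≡m u≤)) (cong suc (trans (*-comm 4 u) (sym eq)))
  case-1 (suc (suc _)) (s≤s (s≤s ()))
row-surjective k i s i<2 s<r | result u (suc c) eq = cases i i<2 c eq
  where
  u≤ : u ≤ 1 + k
  u≤ = s≤s⁻¹ (*-cancelʳ-< 4 u (2 + k) (s≤s⁻¹ (≤-trans (s≤s (s≤s (m≤n+m (u * 4) (toℕ c))))
         (≤-trans (≤-reflexive (cong suc (sym eq))) (≤-trans s<r (≤-reflexive (e k)))))))
    where
    e : ∀ k → 9 + 4 * k ≡ 1 + (2 + k) * 4
    e = solve-∀
  t = 1 + k ∸ u
  t+u : t + u ≡ 1 + k
  t+u = m∸n+n≡m u≤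
  value : ∀ c → s ≡ c + u * 4 → suc c + 4 * u ≡ suc s
  value c eq = cong suc (trans (cong (c +_) (*-comm 4 u)) (sym eq))
  below : ∀ {u} → u ≢ 1 + k → u ≤ 1 + k → k ∸ u + u ≡ k
  below u≢ u≤ = m∸n+n≡m (s≤s⁻¹ (≤∧≢⇒< u≤ u≢))
  even-2 : ∀ u → u ≤ 1 + k → ∃ λ m → row k 0 [ m ]= 2 + 4 * u
  even-2 zero    _  = _ , Even.block₅ k
  even-2 (suc u) u≤ = []=⇒∃ (Even.block₂ k (k ∸ u) u (m∸n+n≡m (s≤s⁻¹ u≤))) (e u)
    where
    e : ∀ u → 6 + 4 * u ≡ 2 + 4 * (1 + u)
    e = solve-∀
  odd-4 : ∃ λ m → row k 1 [ m ]= 4 + 4 * u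
  odd-4 with u ≟ 1 + k
  ... | yes refl = []=⇒∃ (Odd.block₄ k) (e k)
    where
    e : ∀ k → 8 + 4 * k ≡ 4 + 4 * (1 + k)
    e = solve-∀
  ... | no u≢ = _ , Odd.block₃ k (k ∸ u) u (below u≢ u≤)
  cases : ∀ i → i < 2 → (c : Fin 3) → s ≡ suc (toℕ c) + u * 4 → ∃ λ m → row k i [ m ]= suc s
  cases 0 _ zero             eq = []=⇒∃ (proj₂ (even-2 u u≤)) (value 1 eq)
  cases 0 _ (suc zero)       eq = []=⇒∃ (Even.block₄ k t u t+u) (value 2 eq)
  cases 0 _ (suc (suc zero)) eq = []=⇒∃ (Even.block₃ k t u t+u) (value 3 eq)
  cases 1 _ zero             eq = []=⇒∃ (Odd.block₂ k t u t+u) (value 1 eq)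
  cases 1 _ (suc zero)       eq = []=⇒∃ (Odd.block₅ k t u t+u) (value 2 eq)
  cases 1 _ (suc (suc zero)) eq = []=⇒∃ (proj₂ odd-4) (value 3 eq)
  cases (suc (suc _)) (s≤s (s≤s ()))

-- Lifting to residues modulo 4r

-- A lap has an odd number of turns, so the winding number of a walk can be given
-- either parity; this lifts reachability from ℤ/2r to ℤ/4r.
parity-matched : ∀ {k x} w₀ → Reached k x → ∃ λ v → k ⊢ 0 ⟶[ v ] x × ∃₂ λ a b → v + 2 * a ≡ w₀ + 2 * b
parity-matched {k} w₀ (w , p) with halve (w + w₀)
-- Adding 2 w₀ avoids subtracting winding numbers: w + 2 w₀ = w₀ + (w + w₀), and the bracket is
-- even. If it is odd, one more lap makes it even.
... | inj₁ (h , eq) = w , p , w₀ , h , trans (e w w₀) (cong (w₀ +_) (sym eq))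
  where
  e : ∀ w w₀ → w + 2 * w₀ ≡ w₀ + (w + w₀)
  e = solve-∀
... | inj₂ (h , eq) = 1 + 2 * half-turns + w , circuit ∙ p , w₀ , 1 + half-turns + h ,
  trans (e half-turns w w₀) (trans (cong (λ x → w₀ + (1 + 2 * half-turns + x)) (sym eq)) (e′ half-turns h w₀))
  where
  open Lap (lap k) renaming (lap to circuit)
  e : ∀ d w w₀ → 1 + 2 * d + w + 2 * w₀ ≡ w₀ + (1 + 2 * d + (w + w₀))
  e = solve-∀
  e′ : ∀ d h w₀ → w₀ + (1 + 2 * d + (1 + 2 * h)) ≡ w₀ + 2 * (1 + d + h)
  e′ = solve-∀

reached-residue : ∀ k i m → i < 2 → m < 9 + 4 * k → Reached k (i + 2 * m)
reached-residue k 0 m _ m<r = Reaching.reached-even k m m<r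
reached-residue k 1 m _ m<r = Reaching.reached-odd k m m<r
reached-residue k (suc (suc _)) m (s≤s (s≤s ()))

jump-surjective : ∀ k i (s : Fin (9 + 4 * k)) → i < 2 → ∃ λ m → m < 9 + 4 * k × jump k (i + 2 * m) ≡ suc (toℕ s)
jump-surjective k i s i<2 = let m , p = row-surjective k i (toℕ s) i<2 (Fin.toℕ<n s) in
  m , subst (m <_) (length-row k i) ([]=⇒< p) , jump-row k i<2 p

jump-periodic : ∀ k x w → jump k (x + 2 * (9 + 4 * k) * w) ≡ jump k x
jump-periodic k x w = trans (cong (λ p → jump k (x + p * w)) (e k)) (jump-+ k x w)
  where
  e : ∀ k → 2 * (9 + 4 * k) ≡ 18 + 8 * k
  e = solve-∀

-- In the target, i + 2m is the residue modulo 2r and w counts multiples of 2r, so only the parity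
-- of w matters modulo 4r.
walk-reaches-sum : ∀ k i m w → i < 2 → m < 9 + 4 * k →
  ∃ λ n → ∃₂ λ a b → walk k n 0 + a * (4 * (9 + 4 * k)) ≡ i + (m + w * (9 + 4 * k)) * 2 + b * (4 * (9 + 4 * k))
walk-reaches-sum k i m w i<2 m<r = conclude (parity-matched w (reached-residue k i m i<2 m<r))
  where
  e₁ : ∀ k x v a → x + (18 + 8 * k) * v + a * (4 * (9 + 4 * k)) ≡ x + (18 + 8 * k) * (v + 2 * a)
  e₁ = solve-∀
  e₂ : ∀ k i m w b → i + 2 * m + (18 + 8 * k) * (w + 2 * b) ≡
                     i + (m + w * (9 + 4 * k)) * 2 + b * (4 * (9 + 4 * k))
  e₂ = solve-∀
  conclude : (∃ λ v → k ⊢ 0 ⟶[ v ] i + 2 * m × ∃₂ λ a b → v + 2 * a ≡ w + 2 * b) →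
    ∃ λ n → ∃₂ λ a b → walk k n 0 + a * (4 * (9 + 4 * k)) ≡ i + (m + w * (9 + 4 * k)) * 2 + b * (4 * (9 + 4 * k))
  conclude (v , winding (n , eq) , a , b , v≡) = n , a , b ,
    trans (cong (_+ a * (4 * (9 + 4 * k))) eq) (trans (e₁ k (i + 2 * m) v a)
      (trans (cong (λ y → i + 2 * m + (18 + 8 * k) * y) v≡) (e₂ k i m w b)))

winding-length : ∀ {k w} → k ⊢ 0 ⟶[ suc w ] 0 → ∃ λ l → walk k (suc l) 0 ≡ (18 + 8 * k) * suc w
winding-length (winding (suc l , eq)) = l , eq

walk-reaches : ∀ k z → ∃ λ n → ∃₂ λ a b → walk k n 0 + a * (4 * (9 + 4 * k)) ≡ z + b * (4 * (9 + 4 * k))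
walk-reaches k z = subst
  (λ y → ∃ λ n → ∃₂ λ a b → walk k n 0 + a * (4 * (9 + 4 * k)) ≡ y + b * (4 * (9 + 4 * k)))
  (trans (cong (λ y → z % 2 + y * 2) (sym (m≡m%n+[m/n]*n (z / 2) (9 + 4 * k)))) (sym (m≡m%n+[m/n]*n z 2)))
  (walk-reaches-sum k (z % 2) (z / 2 % (9 + 4 * k)) (z / 2 / (9 + 4 * k)) (m%n<n z 2) (m%n<n (z / 2) (9 + 4 * k)))

walk-closes : ∀ k → ∃ λ l → ∃ λ b → walk k (suc l) 0 ≡ b * (4 * (9 + 4 * k))
walk-closes k = let l , eq = winding-length (circuit ∙ circuit) in
  l , 1 + 2 * half-turns , trans eq (e k half-turns)
  where
  open Lap (lap k) renaming (lap to circuit)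
  e : ∀ k d → (18 + 8 * k) * (1 + 2 * d + (1 + 2 * d)) ≡ (1 + 2 * d) * (4 * (9 + 4 * k))
  e = solve-∀

-- The rainbow path and the cut arcs

-- In terms of q the second offset is 8q - 2, so that the index q + 1 yields 10q.
rainbow : ℕ → ℕ → ℕ
rainbow k t with t ≤? 2 + k
... | yes _ = 9 + 4 * k + 2 * t
... | no  _ = 14 + 8 * k + 2 * t

rainbow-low : ∀ k {t} → t ≤ 2 + k → rainbow k t ≡ 9 + 4 * k + 2 * t
rainbow-low k {t} t≤ with t ≤? 2 + k
... | yes _  = refl
... | no t≰ = contradiction t≤ t≰

rainbow-high : ∀ k {t} → 2 + k < t → rainbow k t ≡ 14 + 8 * k + 2 * t
rainbow-high k {t} t> with t ≤? 2 + k
... | yes t≤ = contradiction t≤ (<⇒≱ t>)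
... | no  _  = refl

rainbow≤ : ∀ k t → rainbow k t ≤ 14 + 8 * k + 2 * t
rainbow≤ k t with t ≤? 2 + k
... | yes _ = +-monoˡ-≤ (2 * t) (+-mono-≤ (m≤m+n 9 5) (*-monoˡ-≤ k (m≤m+n 4 4)))
... | no  _ = ≤-refl

rainbow-mono-< : ∀ k {s t} → s < t → rainbow k s < rainbow k t
rainbow-mono-< k {s} {t} s<t with t ≤? 2 + k
... | yes t≤ rewrite rainbow-low k (<⇒≤ (<-≤-trans s<t t≤)) = +-monoʳ-< (9 + 4 * k) (*-monoʳ-< 2 s<t)
... | no  _  = ≤-<-trans (rainbow≤ k s) (+-monoʳ-< (14 + 8 * k) (*-monoʳ-< 2 s<t))

-- The vertices r, 8q and 6q + 3 + 2r, where the jumps are 2, 2 and 4q − 1.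
cut : ℕ → ℕ → ℕ
cut k u with u <? 2 + k | u ≟ 8 + 4 * k
... | yes _ | _     = 9 + 4 * k
... | no  _ | yes _ = 33 + 14 * k
... | no  _ | no  _ = 16 + 8 * k

cut-low : ∀ k {u} → u < 2 + k → cut k u ≡ 9 + 4 * k
cut-low k {u} u< with u <? 2 + k | u ≟ 8 + 4 * k
... | yes _  | _ = refl
... | no  u≮ | _ = contradiction u< u≮

cut-last : ∀ k → cut k (8 + 4 * k) ≡ 33 + 14 * k
cut-last k with 8 + 4 * k <? 2 + k | 8 + 4 * k ≟ 8 + 4 * k
... | yes u< | _     = contradiction u< (≤⇒≯ (+-mono-≤ (m≤m+n 2 6) (m≤m+n k (3 * k))))
... | no  _ | yes _ = refl
... | no  _ | no  ≢ = contradiction refl ≢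

cut-high : ∀ k {u} → 2 + k ≤ u → u ≢ 8 + 4 * k → cut k u ≡ 16 + 8 * k
cut-high k {u} u≥ u≢ with u <? 2 + k | u ≟ 8 + 4 * k
... | yes u< | _     = contradiction u< (≤⇒≯ u≥)
... | no  _ | yes eq = contradiction eq u≢
... | no  _ | no  _ = refl

next-low : ∀ k → next k (9 + 4 * k) ≡ 11 + 4 * k
next-low k = trans (cong (9 + 4 * k +_) jump≡) (+-comm (9 + 4 * k) 2)
  where
  e : ∀ k → 9 + 4 * k ≡ 1 + 2 * (3 + k + (1 + k))
  e = solve-∀
  jump≡ : jump k (9 + 4 * k) ≡ 2
  jump≡ = trans (cong (jump k) (e k)) (jump-row k (s≤s (s≤s z≤n)) (Odd.block₂ k (1 + k) 0 (+-identityʳ _)))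

next-last : ∀ k → next k (33 + 14 * k) ≡ 40 + 18 * k
next-last k = trans (cong (33 + 14 * k +_) jump≡) (e′ k)
  where
  e : ∀ k → 33 + 14 * k ≡ 1 + 2 * (3 + k + (2 + k + (1 + k + 1))) + (18 + 8 * k) * 1
  e = solve-∀
  e′ : ∀ k → 33 + 14 * k + (3 + 4 * (1 + k)) ≡ 40 + 18 * k
  e′ = solve-∀
  jump≡ : jump k (33 + 14 * k) ≡ 3 + 4 * (1 + k)
  jump≡ = trans (cong (jump k) (e k)) (trans (jump-+ k (1 + 2 * (3 + k + (2 + k + (1 + k + 1)))) 1)
    (jump-row k (s≤s (s≤s z≤n)) (Odd.block₅ k 0 (1 + k) refl)))

next-high : ∀ k → next k (16 + 8 * k) ≡ 18 + 8 * k
next-high k = trans (cong (16 + 8 * k +_) jump≡) (+-comm (16 + 8 * k) 2)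
  where
  e : ∀ k → 16 + 8 * k ≡ 2 * (3 + k + (1 + k + (2 + k + (2 + k + 0))))
  e = solve-∀
  jump≡ : jump k (16 + 8 * k) ≡ 2
  jump≡ = trans (cong (jump k) (e k)) (jump-row k (s≤s z≤n) (Even.block₅ k))

-- The odd residue of jump 2 in the base cycle is r, so translate t contains the arc from r + 2t to
-- r + 2t + 2.
start-low : ∀ k {t} → t < 2 + k → rainbow k t ≡ 2 * t + cut k t
start-low k {t} t< = trans (rainbow-low k (<⇒≤ t<))
  (trans (+-comm (9 + 4 * k) (2 * t)) (cong (2 * t +_) (sym (cut-low k t<))))

end-low : ∀ k {t} → t < 2 + k → rainbow k (suc t) ≡ 2 * t + next k (cut k t)
end-low k {t} t< = trans (rainbow-low k t<)
  (trans (e (4 * k) t) (cong (2 * t +_) (sym (trans (cong (next k) (cut-low k t<)) (next-low k)))))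
  where
  e : ∀ k t → 9 + k + 2 * (1 + t) ≡ 2 * t + (11 + k)
  e = solve-∀

-- Translate 4q shifts by 2r - 2, which takes 6q + 3 + 2r to 6q + 1 + 4r. Modulo 4r this is the end
-- of the first run, and jump 4q - 1 leads on to 10q.
start-last : ∀ k → rainbow k (2 + k) + 1 * (4 * (9 + 4 * k)) ≡
                   2 * (8 + 4 * k) + cut k (8 + 4 * k) + 0 * (4 * (9 + 4 * k))
start-last k = trans (cong (_+ 1 * (4 * (9 + 4 * k))) (rainbow-low k ≤-refl))
  (trans (e k) (cong (λ c → 2 * (8 + 4 * k) + c + 0 * (4 * (9 + 4 * k))) (sym (cut-last k))))
  where
  e : ∀ k → 9 + 4 * k + 2 * (2 + k) + 1 * (4 * (9 + 4 * k)) ≡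
            2 * (8 + 4 * k) + (33 + 14 * k) + 0 * (4 * (9 + 4 * k))
  e = solve-∀

end-last : ∀ k → rainbow k (3 + k) + 1 * (4 * (9 + 4 * k)) ≡
                 2 * (8 + 4 * k) + next k (cut k (8 + 4 * k)) + 0 * (4 * (9 + 4 * k))
end-last k = trans (cong (_+ 1 * (4 * (9 + 4 * k))) (rainbow-high k (n<1+n (2 + k))))
  (trans (e k) (cong (λ c → 2 * (8 + 4 * k) + c + 0 * (4 * (9 + 4 * k)))
    (sym (trans (cong (next k) (cut-last k)) (next-last k)))))
  where
  e : ∀ k → 14 + 8 * k + 2 * (3 + k) + 1 * (4 * (9 + 4 * k)) ≡
            2 * (8 + 4 * k) + (40 + 18 * k) + 0 * (4 * (9 + 4 * k))
  e = solve-∀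

-- The even residue of jump 2 is 8q. The index on the path is one ahead of u because the arc at
-- index q belongs to translate 4q.
start-high : ∀ k {u} → 2 + k ≤ u → u ≢ 8 + 4 * k → rainbow k (suc u) ≡ 2 * u + cut k u
start-high k {u} u≥ u≢ = trans (rainbow-high k (s≤s u≥))
  (trans (e (8 * k) u) (cong (2 * u +_) (sym (cut-high k u≥ u≢))))
  where
  e : ∀ k u → 14 + k + 2 * (1 + u) ≡ 2 * u + (16 + k)
  e = solve-∀

end-high : ∀ k {u} → 2 + k ≤ u → u ≢ 8 + 4 * k → rainbow k (2 + u) ≡ 2 * u + next k (cut k u)
end-high k {u} u≥ u≢ = trans (rainbow-high k (m≤n⇒m≤1+n (s≤s u≥)))
  (trans (e (8 * k) u) (cong (2 * u +_) (sym (trans (cong (next k) (cut-high k u≥ u≢)) (next-high k)))))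
  where
  e : ∀ k u → 14 + k + 2 * (2 + u) ≡ 2 * u + (18 + k)
  e = solve-∀

-- Assembly of the decomposition

module Construction (k r : ℕ) .{{_ : NonZero r}} (r≡ : 9 + 4 * k ≡ r) where

  periodic : ∀ x w → jump k (x + 2 * r * w) ≡ jump k x
  periodic = subst (λ r → ∀ x w → jump k (x + 2 * r * w) ≡ jump k x) r≡ (jump-periodic k)

  surjective : ∀ i (s : Fin r) → i < 2 → ∃ λ m → m < r × jump k (i + 2 * m) ≡ suc (toℕ s)
  surjective = subst (λ r → ∀ i (s : Fin r) → i < 2 → ∃ λ m → m < r × jump k (i + 2 * m) ≡ suc (toℕ s))
    r≡ (jump-surjective k)

  open Translates r (jump k) periodic surjective hiding (next; walk; walk-+; Rung)

  ⟦⟧-≡′ : ∀ {x y} a b → x + a * (4 * (9 + 4 * k)) ≡ y + b * (4 * (9 + 4 * k)) → ⟦ x ⟧ ≡ ⟦ y ⟧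
  ⟦⟧-≡′ {x} {y} a b eq = ⟦⟧-≡ a b (subst (λ r → x + a * (4 * r) ≡ y + b * (4 * r)) r≡ eq)

  walk-transitive : ∀ x y → ∃ λ n → ⟦ walk k n x ⟧ ≡ ⟦ y ⟧
  walk-transitive = transitive
    (λ z → let n , a , b , eq = walk-reaches k z in n , ⟦⟧-≡′ a b eq)
    {proj₁ (walk-closes k)}
    (let _ , b , eq = walk-closes k in ⟦⟧-≡′ 0 b (trans (+-identityʳ _) eq))

  Rung : ℕ → ℕ → Set
  Rung t u = ⟦ rainbow k t ⟧ ≡ ⟦ 2 * u + cut k u ⟧ ×
             ⟦ rainbow k (suc t) ⟧ ≡ ⟦ 2 * u + next k (cut k u) ⟧

  rung-low : ∀ {t} → t < 2 + k → Rung t t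
  rung-low t< = cong ⟦_⟧ (start-low k t<) , cong ⟦_⟧ (end-low k t<)

  rung-last : Rung (2 + k) (8 + 4 * k)
  rung-last = ⟦⟧-≡′ 1 0 (start-last k) , ⟦⟧-≡′ 1 0 (end-last k)

  rung-high : ∀ {u} → 2 + k ≤ u → u ≢ 8 + 4 * k → Rung (suc u) u
  rung-high u≥ u≢ = cong ⟦_⟧ (start-high k u≥ u≢) , cong ⟦_⟧ (end-high k u≥ u≢)

  rung-at : ∀ {t} → t < 9 + 4 * k → ∃ λ u → u < 9 + 4 * k × Rung t u
  rung-at {t} t<r with <-cmp t (2 + k)
  ... | tri< t< _ _    = t , t<r , rung-low t<
  ... | tri≈ _ refl _  = 8 + 4 * k , n<1+n _ , rung-last
  rung-at {suc u} t<r | tri> _ _ t> =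
    u , <-trans (n<1+n u) t<r , rung-high (s≤s⁻¹ t>) (<⇒≢ (s≤s⁻¹ t<r))

  rung-of : ∀ u → u < 9 + 4 * k → ∃ λ t → t < 9 + 4 * k × Rung t u
  rung-of u u<r with <-≤-connex u (2 + k) | m≤n⇒m<n∨m≡n (s≤s⁻¹ u<r)
  ... | inj₁ u< | _         = u , u<r , rung-low u<
  ... | inj₂ _  | inj₂ refl = 2 + k , +-mono-≤ (m≤m+n 3 6) (m≤m+n k (3 * k)) , rung-last
  ... | inj₂ u≥ | inj₁ u<   = suc u , s≤s u< , rung-high u≥ (<⇒≢ u<)

  -- The sequence increases and ends at 16q = 4r - 4, so it stays within one period.
  rainbow-injective : ∀ {s t} → s < t → t ≤ r → ⟦ rainbow k s ⟧ ≢ ⟦ rainbow k t ⟧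
  rainbow-injective {s} {t} s<t t≤r eq = <⇒≢ s<t′
    (⟦⟧-injective-< (<-trans s<t′ t<4r) t<4r eq)
    where
    s<t′ : rainbow k s < rainbow k t
    s<t′ = rainbow-mono-< k s<t
    e : ∀ k → 4 + (14 + 8 * k + 2 * (9 + 4 * k)) ≡ 4 * (9 + 4 * k)
    e = solve-∀
    t<4r : rainbow k t < 4 * r
    t<4r = begin-strict
      rainbow k t                                  ≤⟨ rainbow≤ k t ⟩
      14 + 8 * k + 2 * t                           ≤⟨ +-monoʳ-≤ (14 + 8 * k) (*-monoʳ-≤ 2 (subst (t ≤_) (sym r≡) t≤r)) ⟩
      14 + 8 * k + 2 * (9 + 4 * k)                 <⟨ m<n+m (14 + 8 * k + 2 * (9 + 4 * k)) {4} z<s ⟩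
      4 + (14 + 8 * k + 2 * (9 + 4 * k))           ≡⟨ e k ⟩
      4 * (9 + 4 * k)                              ≡⟨ cong (4 *_) r≡ ⟩
      4 * r                                        ∎
      where open ≤-Reasoning

  decomposition : PathDecomposition (𝒞₄ r) (suc r)
  decomposition = Rainbow.decomposition walk-transitive (cut k ∘ toℕ) (rainbow k) rainbow-injective
    (λ {t} t<r → let u , u<r , rung = rung-at (subst (t <_) (sym r≡) t<r)
                     u<r′ = subst (u <_) r≡ u<r
                 in fromℕ< u<r′ , subst (Rung t) (sym (Fin.toℕ-fromℕ< u<r′)) rung)
    (λ u → let t , t<r , rung = rung-of (toℕ u) (subst (toℕ u <_) (sym r≡) (Fin.toℕ<n u))
           in t , subst (t <_) r≡ t<r , rung)

theorem5p5 : (r : ℕ) → r % 4 ≡ 1 → 9 ≤ r → IsPathNumber (𝒞₄ r) (r + 1)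
theorem5p5 r r%4≡1 9≤r = subst (IsPathNumber (𝒞₄ r)) (+-comm 1 r) record
  { attained = Construction.decomposition (r / 4 ∸ 2) r {{r≢0}} (sym r≡)
  ; minimum  = Cayley.pathNumber-lowerBound r {{r≢0}}
  }
  where
  r≢0 : NonZero r
  r≢0 = >-nonZero (<-≤-trans z<s 9≤r)
  q≥2 : 2 ≤ r / 4
  q≥2 = /-monoˡ-≤ 4 (≤-trans (m≤m+n 8 1) 9≤r)
  e : ∀ k → 1 + (2 + k) * 4 ≡ 9 + 4 * k
  e = solve-∀
  r≡ : r ≡ 9 + 4 * (r / 4 ∸ 2)
  r≡ = begin
    r                          ≡⟨ m≡m%n+[m/n]*n r 4 ⟩
    r % 4 + r / 4 * 4          ≡⟨ cong₂ (λ a b → a + b * 4) r%4≡1 (sym (m+[n∸m]≡n q≥2)) ⟩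
    1 + (2 + (r / 4 ∸ 2)) * 4  ≡⟨ e (r / 4 ∸ 2) ⟩
    9 + 4 * (r / 4 ∸ 2)        ∎
    where open ≡-Reasoning
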